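{- Let $k$ be a field and $A$ a finite-dimensional $k$-algebra. Then $(\operatorname{Bricks}(A),\to,\twoheadrightarrow,\hookrightarrow)$ is a two-acyclic factorization system. Furthermore, $(\mathcal T,\mathcal F)\mapsto(\mathcal T\cap\operatorname{Bricks}(A),\mathcal F\cap\operatorname{Bricks}(A))$ is an isomorphism from $\operatorname{tors}(A)$ to $\operatorname{Pairs}(\to)$. The inverse map takes $(X,Y)$ to $(\mathcal T,\mathcal F)$, where $\mathcal T$ consists of the modules filtered by quotients of bricks from $X$, and $\mathcal F$ consists of the modules filtered by submodules of modules from $Y$.
   Context: Representation theory: All modules are finite-dimensional $A$-modules. A torsion class is a full subcategory $\mathcal T$ of the category of finite-dimensional $A$-modules (closed under isomorphism and containing $0$) closed under extensions and quotients; a torsion-free class is one closed under extensions and submodules. To a torsion class $\mathcal T$ corresponds the torsion-free class $\mathcal F=\{M:\operatorname{Hom}(L,M)=0\text{ for all }L\in\mathcal T\}$, and $\mathcal T=\{L:\operatorname{Hom}(L,M)=0\text{ for all }M\in\mathcal F\}$; such $(\mathcal T,\mathcal F)$ is a torsion pair. $\operatorname{tors}(A)$ is the complete lattice of torsion classes under inclusion; its elements are identified with torsion pairs $(\mathcal T,\mathcal F)$ (inclusion of torsion classes being reverse inclusion of torsion-free classes). A brick is a (nonzero) $A$-module whose endomorphism ring is a division algebra; $\operatorname{Bricks}(A)$ is the set of isomorphism classes $[M]$ of bricks. A module $M$ is filtered by modules of a certain kind if there is a filtration $0=M_0\subset M_1\subset\cdots\subset M_r=M$ with every $M_i/M_{i-1}$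 isomorphic to a module of that kind. Relations on $\operatorname{Bricks}(A)$: $[L]\to[M]$ iff $\operatorname{Hom}(L,M)\ne0$; $[L]\twoheadrightarrow[M]$ iff $M$ is filtered by quotients of $L$; $[L]\hookrightarrow[M]$ iff $L$ is filtered by submodules of $M$. Factorization systems: For a binary relation $\to$ on a set $S$ and $X\subseteq S$, put $X^\perp=\{y\in S: x\not\to y\ \forall x\in X\}$ and ${}^\perp X=\{y\in S: y\not\to x\ \forall x\in X\}$. A maximal orthogonal pair is a pair $(X,Y)$ of subsets of $S$ with $Y=X^\perp$ and $X={}^\perp Y$. $\operatorname{Pairs}(\to)$ is the set of maximal orthogonal pairs, partially ordered by containment of first components. For a reflexive relation $\to$ on $S$, $\operatorname{Fact}(\to)=(\twoheadrightarrow,\hookrightarrow)$, where $x\twoheadrightarrow y$ iff for all $z\in S$, $y\to z$ implies $x\to z$, and $x\hookrightarrow y$ iff for all $z\in S$, $z\to x$ implies $z\to y$. For preorders $\twoheadrightarrow,\hookrightarrow$, $\operatorname{Mult}(\twoheadrightarrow,\hookrightarrow)$ is the relation relating $x$ to $z$ iff there is $y\in S$ with $x\twoheadrightarrow y\hookrightarrow z$. A factorization system is a tuple $(S,\to,\twoheadrightarrow,\hookrightarrow)$ ($S$ possibly infinite) with $\to$ reflexive, $\operatorname{Fact}(\to)=(\twoheadrightarrow,\hookrightarrow)$ and $\operatorname{Mult}(\twoheadrightarrow,\hookrightarrow)=\to$. It is two-acyclic if $x\twoheadrightarrow y\twoheadrightarrow x$ implies $x=y$, $x\hookrightarrow y\hookrightarrow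 x$ implies $x=y$, and $x\twoheadrightarrow y\hookrightarrow x$ implies $x=y$. -}

module Defs where

open import Level using (Level; suc; _⊔_)
open import Algebra.Bundles using (Ring; CommutativeRing; CommutativeMonoid)
import Algebra.Definitions as AlgebraDefinitions
import Algebra.Definitions.RawMonoid as RawMonoidDefinitions
open import Algebra.Morphism.Structures using (module RingMorphisms)
open import Algebra.Module.Bundles using (LeftModule)
open import Algebra.Module.Morphism.Structures using (module LeftModuleMorphisms)
import Algebra.Module.Construct.TensorUnit as TensorUnit
import Algebra.Module.Construct.Zero as Zero
import Algebra.Module.Morphism.Construct.Identity as Identity
import Algebra.Module.Morphism.Construct.Composition as Composition
import Algebra.Module.Properties.LeftModule as LeftModuleProperties
import Algebra.Properties.AbelianGroup as AbelianGroupProperties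
import Algebra.Properties.CommutativeSemigroup as CommutativeSemigroupProperties
open import Data.Fin.Base using (Fin; inject₁; fromℕ) renaming (zero to fzero; suc to fsuc)
open import Data.Nat.Base using (ℕ) renaming (suc to sucℕ)
open import Data.Product.Base using (Σ; ∃; ∃-syntax; Σ-syntax; _×_; _,_; proj₁; proj₂)
open import Data.Unit.Polymorphic using (tt)
open import Function.Base using (_on_)
open import Function.Bundles using () renaming (_⇔_ to _iff_)
open import Function.Definitions using (Injective; Surjective; Inverseᵇ)
open import Relation.Binary.Bundles using (Setoid; Poset)
open import Relation.Binary.Core using (Rel; _⇔_)
open import Relation.Binary.Definitions using (Reflexive; _Respects₂_)
open import Relation.Binary.Morphism.Structures using (IsOrderIsomorphism)
open import Relation.Binary.Structures using (IsEquivalence)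
import Relation.Binary.Construct.On as On
import Relation.Binary.Reasoning.Setoid as SetoidReasoning
open import Relation.Nullary using (¬_)
open import Relation.Unary using (Pred; _∈_; _⊆_; _≐_)
open import Relation.Unary.Properties using (≐-refl; ≐-sym; ≐-trans)
open import Relation.Unary.Relation.Binary.Subset using (⊆-poset)

------------------------------------------------------------------------
-- Factorization systems on a set S.  Sets are setoids, so relations and
-- subsets are required to respect the equality _≈_ of S.

module FactorizationSystems {a e : Level} (S : Setoid a e) where

  open Setoid S using (_≈_) renaming (Carrier to ∣S∣)

  private
    variable
      p q r r₁ r₂ r₃ : Level

  _^⊥[_] : Pred ∣S∣ p → Rel ∣S∣ r → Pred ∣S∣ (a ⊔ p ⊔ r)
  (X ^⊥[ _⟶_ ]) y = ∀ {x} → x ∈ X → ¬ (x ⟶ y)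

  ⊥^[_]_ : Rel ∣S∣ r → Pred ∣S∣ p → Pred ∣S∣ (a ⊔ p ⊔ r)
  (⊥^[ _⟶_ ] Y) x = ∀ {y} → y ∈ Y → ¬ (x ⟶ y)

  IsSubset : Pred ∣S∣ p → Set (a ⊔ e ⊔ p)
  IsSubset X = ∀ {x y} → x ≈ y → x ∈ X → y ∈ X

  record IsMaximalOrthogonalPair (_⟶_ : Rel ∣S∣ r) (X : Pred ∣S∣ p) (Y : Pred ∣S∣ q)
         : Set (a ⊔ e ⊔ r ⊔ p ⊔ q) where
    field
      X-isSubset : IsSubset X
      Y-isSubset : IsSubset Y
      Y≐X^⊥      : Y ≐ X ^⊥[ _⟶_ ]
      X≐⊥^Y      : X ≐ ⊥^[ _⟶_ ] Y

  record MaximalOrthogonalPair (_⟶_ : Rel ∣S∣ r) (p : Level) : Set (a ⊔ e ⊔ r ⊔ suc p) where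
    constructor pair
    field
      X Y    : Pred ∣S∣ p
      isPair : IsMaximalOrthogonalPair _⟶_ X Y
    open IsMaximalOrthogonalPair isPair public

  Pairs : (_⟶_ : Rel ∣S∣ r) (p : Level) → Poset (a ⊔ e ⊔ r ⊔ suc p) (a ⊔ p) (a ⊔ p)
  Pairs {r} _⟶_ p = record
    { Carrier        = Pair
    ; _≈_            = λ P Q → (X P ≐ X Q) × (Y P ≐ Y Q)
    ; _≤_            = λ P Q → X P ⊆ X Q
    ; isPartialOrder = record
      { isPreorder = record
        { isEquivalence = record
          { refl  = ≐-refl , ≐-refl
          ; sym   = λ (f , g) → ≐-sym f , ≐-sym g
          ; trans = λ (f , g) (f′ , g′) → ≐-trans f f′ , ≐-trans g g′
          }
        ; reflexive = λ ((f , _) , _) → f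
        ; trans     = λ f g x → g (f x)
        }
      ; antisym = λ {P} {Q} f g → (f , g) , Y-antitone Q P g , Y-antitone P Q f
      }
    }
    where
    Pair : Set (a ⊔ e ⊔ r ⊔ suc p)
    Pair = MaximalOrthogonalPair _⟶_ p
    open MaximalOrthogonalPair
    Y-antitone : (P Q : Pair) → X P ⊆ X Q → Y Q ⊆ Y P
    Y-antitone P Q f y = proj₂ (Y≐X^⊥ P) (λ x → proj₁ (Y≐X^⊥ Q) y (f x))

  Fact-↠ : Rel ∣S∣ r → Rel ∣S∣ (a ⊔ r)
  Fact-↠ _⟶_ x y = ∀ z → y ⟶ z → x ⟶ z

  Fact-↪ : Rel ∣S∣ r → Rel ∣S∣ (a ⊔ r)
  Fact-↪ _⟶_ x y = ∀ z → z ⟶ x → z ⟶ y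

  Mult : Rel ∣S∣ r₁ → Rel ∣S∣ r₂ → Rel ∣S∣ (a ⊔ r₁ ⊔ r₂)
  Mult _↠_ _↪_ x z = ∃[ y ] (x ↠ y) × (y ↪ z)

  record IsFactorizationSystem (_⟶_ : Rel ∣S∣ r₁) (_↠_ : Rel ∣S∣ r₂) (_↪_ : Rel ∣S∣ r₃)
         : Set (a ⊔ e ⊔ r₁ ⊔ r₂ ⊔ r₃) where
    field
      ⟶-resp-≈ : _⟶_ Respects₂ _≈_
      ↠-resp-≈ : _↠_ Respects₂ _≈_
      ↪-resp-≈ : _↪_ Respects₂ _≈_
      ⟶-refl   : Reflexive _⟶_
      fact-↠   : Fact-↠ _⟶_ ⇔ _↠_
      fact-↪   : Fact-↪ _⟶_ ⇔ _↪_
      mult     : Mult _↠_ _↪_ ⇔ _⟶_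

  record IsTwoAcyclic (_↠_ : Rel ∣S∣ r₂) (_↪_ : Rel ∣S∣ r₃) : Set (a ⊔ e ⊔ r₂ ⊔ r₃) where
    field
      ↠-acyclic  : ∀ {x y} → x ↠ y → y ↠ x → x ≈ y
      ↪-acyclic  : ∀ {x y} → x ↪ y → y ↪ x → x ≈ y
      ↠↪-acyclic : ∀ {x y} → x ↠ y → y ↪ x → x ≈ y

------------------------------------------------------------------------
-- Fields and finite-dimensional algebras

record IsDivisionRing {c ℓ} (R : Ring c ℓ) : Set (c ⊔ ℓ) where
  open Ring R
  open AlgebraDefinitions _≈_ using (Invertible)
  field
    1≉0        : ¬ (1# ≈ 0#)
    invertible : ∀ x → ¬ (x ≈ 0#) → Invertible 1# _*_ x

record Field (ℓ : Level) : Set (suc ℓ) where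
  field
    commutativeRing : CommutativeRing ℓ ℓ
    isDivisionRing  : IsDivisionRing (CommutativeRing.ring commutativeRing)
  open CommutativeRing commutativeRing public

-- A unital associative k-algebra is a ring with a ring homomorphism ι from k
-- to its centre; c ∈ k then acts on any left A-module as ι c does.
record Algebra {ℓ : Level} (k : Field ℓ) : Set (suc ℓ) where
  private module k = Field k
  field
    ring : Ring ℓ ℓ
  open Ring ring public
  open RingMorphisms k.rawRing rawRing using (IsRingHomomorphism)
  field
    ι         : k.Carrier → Carrier
    ι-homo    : IsRingHomomorphism ι
    ι-central : ∀ c x → ι c * x ≈ x * ι c

-- Finite-dimensional over k: spanned over k by a finite family.
FiniteDimensional : ∀ {ℓ} {k : Field ℓ} (A : Algebra k) → LeftModule (Algebra.ring A) ℓ ℓ → Set ℓ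
FiniteDimensional {k = k} A M =
  Σ[ n ∈ ℕ ] Σ[ v ∈ (Fin n → Carrierᴹ) ]
    ∀ x → Σ[ c ∈ (Fin n → Field.Carrier k) ] x ≈ᴹ sum (λ i → ι (c i) *ₗ v i)
  where
  open Algebra A using (ι)
  open LeftModule M
  open RawMonoidDefinitions +ᴹ-rawMonoid using (sum)

record FiniteDimensionalAlgebra {ℓ : Level} (k : Field ℓ) : Set (suc ℓ) where
  field
    algebra           : Algebra k
    finiteDimensional : FiniteDimensional algebra TensorUnit.leftModule
  open Algebra algebra public

------------------------------------------------------------------------
-- Left modules over a ring

module Modules {ℓ : Level} (R : Ring ℓ ℓ) where

  private
    module R = Ring R
    Mod : Set (suc ℓ)
    Mod = LeftModule R ℓ ℓ

  record Hom (M N : Mod) : Set ℓ where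
    private
      module M = LeftModule M
      module N = LeftModule N
    field
      ⟦_⟧    : M.Carrierᴹ → N.Carrierᴹ
      isHomo : LeftModuleMorphisms.IsLeftModuleHomomorphism M.rawLeftModule N.rawLeftModule ⟦_⟧
    open LeftModuleMorphisms.IsLeftModuleHomomorphism isHomo public

    IsZero IsInjective IsSurjective : Set ℓ
    IsZero       = ∀ x → ⟦ x ⟧ N.≈ᴹ N.0ᴹ
    IsInjective  = Injective M._≈ᴹ_ N._≈ᴹ_ ⟦_⟧
    IsSurjective = Surjective M._≈ᴹ_ N._≈ᴹ_ ⟦_⟧

  open Hom

  HomIsZero : Mod → Mod → Set ℓ
  HomIsZero M N = (f : Hom M N) → IsZero f

  HomIsNonzero : Mod → Mod → Set ℓ
  HomIsNonzero M N = Σ[ f ∈ Hom M N ] ¬ IsZero f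

  _≅_ : Rel Mod ℓ
  M ≅ N = ∃ (LeftModuleMorphisms.IsLeftModuleIsomorphism (LeftModule.rawLeftModule M) (LeftModule.rawLeftModule N))

  QuotientOf SubmoduleOf : Mod → Mod → Set ℓ
  QuotientOf  M N = Σ[ f ∈ Hom M N ] IsSurjective f
  SubmoduleOf M N = Σ[ f ∈ Hom N M ] IsInjective f

  record ShortExact (L M N : Mod) : Set ℓ where
    field
      f          : Hom L M
      g          : Hom M N
      injective  : IsInjective f
      surjective : IsSurjective g
      exact      : ∀ y → LeftModule._≈ᴹ_ N (⟦ g ⟧ y) (LeftModule.0ᴹ N)
                         iff (∃[ x ] LeftModule._≈ᴹ_ M (⟦ f ⟧ x) y)

  module _ {M N : Mod} where
    private
      module M = LeftModule M
      module N = LeftModule N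
      open LeftModuleMorphisms M.rawLeftModule N.rawLeftModule

    mkIsHomo : {f : M.Carrierᴹ → N.Carrierᴹ} →
               (∀ {x y} → x M.≈ᴹ y → f x N.≈ᴹ f y) →
               (∀ x y → f (x M.+ᴹ y) N.≈ᴹ f x N.+ᴹ f y) →
               (∀ r x → f (r M.*ₗ x) N.≈ᴹ r N.*ₗ f x) →
               IsLeftModuleHomomorphism f
    mkIsHomo {f} cong add mul = record
      { +ᴹ-isGroupHomomorphism = record
        { isMonoidHomomorphism = record
          { isMagmaHomomorphism = record
            { isRelHomomorphism = record { cong = cong }
            ; homo              = add
            }
          ; ε-homo = zero-homo
          }
        ; ⁻¹-homo = λ x → inverseʳ-uniqueᴹ (f x) (f (M.-ᴹ x)) (begin
            f x N.+ᴹ f (M.-ᴹ x)  ≈⟨ add x (M.-ᴹ x) ⟨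
            f (x M.+ᴹ M.-ᴹ x)    ≈⟨ cong (M.-ᴹ‿inverseʳ x) ⟩
            f M.0ᴹ               ≈⟨ zero-homo ⟩
            N.0ᴹ                 ∎)
        }
      ; *ₗ-homo = mul
      }
      where
      open LeftModuleProperties N using (inverseʳ-uniqueᴹ)
      open SetoidReasoning N.≈ᴹ-setoid
      zero-homo : f M.0ᴹ N.≈ᴹ N.0ᴹ
      zero-homo = begin
        f M.0ᴹ              ≈⟨ cong (M.*ₗ-zeroˡ M.0ᴹ) ⟨
        f (R.0# M.*ₗ M.0ᴹ)  ≈⟨ mul R.0# M.0ᴹ ⟩
        R.0# N.*ₗ f M.0ᴹ    ≈⟨ N.*ₗ-zeroˡ (f M.0ᴹ) ⟩
        N.0ᴹ                ∎

  ≅-isEquivalence : IsEquivalence _≅_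
  ≅-isEquivalence = record
    { refl  = λ {M} → _ , Identity.isLeftModuleIsomorphism (LeftModule.rawLeftModule M) (LeftModule.≈ᴹ-refl M)
    ; sym   = λ {M} {N} → ≅-sym {M} {N}
    ; trans = λ {_} {_} {N} (_ , F) (_ , G) → _ , Composition.isLeftModuleIsomorphism (LeftModule.≈ᴹ-trans N) F G
    }
    where
    ≅-sym : ∀ {M N} → M ≅ N → N ≅ M
    ≅-sym {M} {N} (f , F) = g , record
      { isLeftModuleMonomorphism = record
        { isLeftModuleHomomorphism = mkIsHomo {N} {M}
            (λ y≈y′ → F.injective (N.≈ᴹ-trans (fg _) (N.≈ᴹ-trans y≈y′ (N.≈ᴹ-sym (fg _)))))
            (λ x y → F.injective (N.≈ᴹ-trans (fg _) (N.≈ᴹ-sym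
              (N.≈ᴹ-trans (F.+ᴹ-homo _ _) (N.+ᴹ-cong (fg x) (fg y))))))
            (λ r x → F.injective (N.≈ᴹ-trans (fg _) (N.≈ᴹ-sym
              (N.≈ᴹ-trans (F.*ₗ-homo _ _) (N.*ₗ-congˡ (fg x))))))
        ; injective = λ gx≈gy → N.≈ᴹ-trans (N.≈ᴹ-sym (fg _)) (N.≈ᴹ-trans (F.⟦⟧-cong gx≈gy) (fg _))
        }
      ; surjective = λ x → f x , λ z≈fx → F.injective (N.≈ᴹ-trans (fg _) z≈fx)
      }
      where
      module M = LeftModule M
      module N = LeftModule N
      module F = LeftModuleMorphisms.IsLeftModuleIsomorphism F
      g : N.Carrierᴹ → M.Carrierᴹ
      g y = proj₁ (F.surjective y)
      fg : ∀ y → f (g y) N.≈ᴹ y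
      fg y = proj₂ (F.surjective y) M.≈ᴹ-refl

  endRing : Mod → Ring ℓ ℓ
  endRing M = record
    { Carrier = Hom M M
    ; _≈_     = λ f g → ∀ x → ⟦ f ⟧ x ≈ᴹ ⟦ g ⟧ x
    ; _+_     = λ f g → record
      { ⟦_⟧    = λ x → ⟦ f ⟧ x +ᴹ ⟦ g ⟧ x
      ; isHomo = mkIsHomo {M} {M}
          (λ x≈y → +ᴹ-cong (⟦⟧-cong f x≈y) (⟦⟧-cong g x≈y))
          (λ x y → ≈ᴹ-trans (+ᴹ-cong (+ᴹ-homo f x y) (+ᴹ-homo g x y)) (interchange _ _ _ _))
          (λ r x → ≈ᴹ-trans (+ᴹ-cong (*ₗ-homo f r x) (*ₗ-homo g r x)) (≈ᴹ-sym (*ₗ-distribˡ r _ _)))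
      }
    ; _*_     = λ f g → record
      { ⟦_⟧    = λ x → ⟦ f ⟧ (⟦ g ⟧ x)
      ; isHomo = Composition.isLeftModuleHomomorphism ≈ᴹ-trans (isHomo g) (isHomo f)
      }
    ; -_      = λ f → record
      { ⟦_⟧    = λ x → -ᴹ ⟦ f ⟧ x
      ; isHomo = mkIsHomo {M} {M}
          (λ x≈y → -ᴹ‿cong (⟦⟧-cong f x≈y))
          (λ x y → ≈ᴹ-trans (-ᴹ‿cong (+ᴹ-homo f x y)) (≈ᴹ-sym (⁻¹-∙-comm _ _)))
          (λ r x → ≈ᴹ-trans (≈ᴹ-sym (-ᴹ-homo f _))
                    (≈ᴹ-trans (⟦⟧-cong f (≈ᴹ-sym (*ₗ-neg r x)))
                    (≈ᴹ-trans (*ₗ-homo f r (-ᴹ x)) (*ₗ-congˡ (-ᴹ-homo f x)))))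
      }
    ; 0#      = record
      { ⟦_⟧    = λ _ → 0ᴹ
      ; isHomo = mkIsHomo {M} {M} (λ _ → ≈ᴹ-refl) (λ _ _ → ≈ᴹ-sym (+ᴹ-identityˡ 0ᴹ)) (λ r _ → ≈ᴹ-sym (*ₗ-zeroʳ r))
      }
    ; 1#      = record
      { ⟦_⟧    = λ x → x
      ; isHomo = Identity.isLeftModuleHomomorphism rawLeftModule ≈ᴹ-refl
      }
    ; isRing  = record
      { +-isAbelianGroup = record
        { isGroup = record
          { isMonoid = record
            { isSemigroup = record
              { isMagma = record
                { isEquivalence = record
                  { refl  = λ _ → ≈ᴹ-refl
                  ; sym   = λ f≈g x → ≈ᴹ-sym (f≈g x)
                  ; trans = λ f≈g g≈h x → ≈ᴹ-trans (f≈g x) (g≈h x)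
                  }
                ; ∙-cong = λ f≈g h≈k x → +ᴹ-cong (f≈g x) (h≈k x)
                }
              ; assoc = λ f g h x → +ᴹ-assoc _ _ _
              }
            ; identity = (λ f x → +ᴹ-identityˡ _) , (λ f x → +ᴹ-identityʳ _)
            }
          ; inverse = (λ f x → -ᴹ‿inverseˡ _) , (λ f x → -ᴹ‿inverseʳ _)
          ; ⁻¹-cong = λ f≈g x → -ᴹ‿cong (f≈g x)
          }
        ; comm = λ f g x → +ᴹ-comm _ _
        }
      ; *-cong     = λ {f} f≈g h≈k x → ≈ᴹ-trans (⟦⟧-cong f (h≈k x)) (f≈g _)
      ; *-assoc    = λ f g h x → ≈ᴹ-refl
      ; *-identity = (λ f x → ≈ᴹ-refl) , (λ f x → ≈ᴹ-refl)
      ; distrib    = (λ f g h x → +ᴹ-homo f _ _) , (λ f g h x → ≈ᴹ-refl)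
      }
    }
    where
    open LeftModule M
    open CommutativeMonoid +ᴹ-commutativeMonoid using () renaming (commutativeSemigroup to +ᴹ-commutativeSemigroup)
    open LeftModuleProperties M using (inverseʳ-uniqueᴹ)
    open AbelianGroupProperties +ᴹ-abelianGroup using (⁻¹-∙-comm)
    open CommutativeSemigroupProperties +ᴹ-commutativeSemigroup using (interchange)
    *ₗ-neg : ∀ r x → r *ₗ (-ᴹ x) ≈ᴹ -ᴹ (r *ₗ x)
    *ₗ-neg r x = inverseʳ-uniqueᴹ _ _
      (≈ᴹ-trans (≈ᴹ-sym (*ₗ-distribˡ r x (-ᴹ x)))
      (≈ᴹ-trans (*ₗ-congˡ (-ᴹ‿inverseʳ x)) (*ₗ-zeroʳ r)))

  record Submodule (M : Mod) : Set (suc ℓ) where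
    open LeftModule M
    field
      member    : Pred Carrierᴹ ℓ
      resp-≈ᴹ   : ∀ {x y} → x ≈ᴹ y → x ∈ member → y ∈ member
      0ᴹ-closed : 0ᴹ ∈ member
      +ᴹ-closed : ∀ {x y} → x ∈ member → y ∈ member → x +ᴹ y ∈ member
      *ₗ-closed : ∀ r {x} → x ∈ member → r *ₗ x ∈ member

    -ᴹ-closed : ∀ {x} → x ∈ member → -ᴹ x ∈ member
    -ᴹ-closed {x} x∈ = resp-≈ᴹ (inverseʳ-uniqueᴹ x _ (begin
        x +ᴹ (R.- R.1#) *ₗ x          ≈⟨ +ᴹ-congʳ (*ₗ-identityˡ x) ⟨
        R.1# *ₗ x +ᴹ (R.- R.1#) *ₗ x  ≈⟨ *ₗ-distribʳ x R.1# (R.- R.1#) ⟨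
        (R.1# R.+ R.- R.1#) *ₗ x      ≈⟨ *ₗ-congʳ (R.-‿inverseʳ R.1#) ⟩
        R.0# *ₗ x                     ≈⟨ *ₗ-zeroˡ x ⟩
        0ᴹ                            ∎))
      (*ₗ-closed (R.- R.1#) x∈)
      where
      open LeftModuleProperties M using (inverseʳ-uniqueᴹ)
      open SetoidReasoning ≈ᴹ-setoid

  -- N / P for P ⊆ N ⊆ M: the elements of N, with x and y identified when
  -- x - y ∈ P.  It is only used when P ⊆ N.
  _/_ : {M : Mod} → Submodule M → Submodule M → Mod
  _/_ {M} N P = record
    { Carrierᴹ     = Σ Carrierᴹ N.member
    ; _≈ᴹ_         = λ x y → proj₁ x ~ proj₁ y
    ; _+ᴹ_         = λ (x , x∈) (y , y∈) → x +ᴹ y , N.+ᴹ-closed x∈ y∈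
    ; _*ₗ_         = λ r (x , x∈) → r *ₗ x , N.*ₗ-closed r x∈
    ; 0ᴹ           = 0ᴹ , N.0ᴹ-closed
    ; -ᴹ_          = λ (x , x∈) → -ᴹ x , N.-ᴹ-closed x∈
    ; isLeftModule = record
      { isLeftSemimodule = record
        { +ᴹ-isCommutativeMonoid = record
          { isMonoid = record
            { isSemigroup = record
              { isMagma = record
                { isEquivalence = record
                  { refl  = ≈⇒~ ≈ᴹ-refl
                  ; sym   = ~-sym
                  ; trans = ~-trans
                  }
                ; ∙-cong = ~-+-cong
                }
              ; assoc = λ _ _ _ → ≈⇒~ (+ᴹ-assoc _ _ _)
              }
            ; identity = (λ _ → ≈⇒~ (+ᴹ-identityˡ _)) , (λ _ → ≈⇒~ (+ᴹ-identityʳ _))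
            }
          ; comm = λ _ _ → ≈⇒~ (+ᴹ-comm _ _)
          }
        ; isPreleftSemimodule = record
          { *ₗ-cong      = λ r≈s x~y → ~-trans (≈⇒~ (*ₗ-congʳ r≈s)) (~-*ₗ-cong _ x~y)
          ; *ₗ-zeroˡ     = λ _ → ≈⇒~ (*ₗ-zeroˡ _)
          ; *ₗ-distribʳ  = λ _ _ _ → ≈⇒~ (*ₗ-distribʳ _ _ _)
          ; *ₗ-identityˡ = λ _ → ≈⇒~ (*ₗ-identityˡ _)
          ; *ₗ-assoc     = λ _ _ _ → ≈⇒~ (*ₗ-assoc _ _ _)
          ; *ₗ-zeroʳ     = λ _ → ≈⇒~ (*ₗ-zeroʳ _)
          ; *ₗ-distribˡ  = λ _ _ _ → ≈⇒~ (*ₗ-distribˡ _ _ _)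
          }
        }
      ; -ᴹ‿cong    = λ x~y → P.resp-≈ᴹ (≈ᴹ-sym (⁻¹-∙-comm _ _)) (P.-ᴹ-closed x~y)
      ; -ᴹ‿inverse = (λ _ → ≈⇒~ (-ᴹ‿inverseˡ _)) , (λ _ → ≈⇒~ (-ᴹ‿inverseʳ _))
      }
    }
    where
    open LeftModule M
    open CommutativeMonoid +ᴹ-commutativeMonoid using () renaming (commutativeSemigroup to +ᴹ-commutativeSemigroup)
    module N = Submodule N
    module P = Submodule P
    open LeftModuleProperties M using (inverseʳ-uniqueᴹ; -ᴹ-involutive)
    open AbelianGroupProperties +ᴹ-abelianGroup using (⁻¹-∙-comm)
    open CommutativeSemigroupProperties +ᴹ-commutativeSemigroup using (interchange)
    open SetoidReasoning ≈ᴹ-setoid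

    infix 4 _~_
    _~_ : Rel Carrierᴹ ℓ
    x ~ y = x +ᴹ -ᴹ y ∈ P.member

    ≈⇒~ : ∀ {x y} → x ≈ᴹ y → x ~ y
    ≈⇒~ {x} {y} x≈y = P.resp-≈ᴹ (≈ᴹ-sym (≈ᴹ-trans (+ᴹ-congʳ x≈y) (-ᴹ‿inverseʳ y))) P.0ᴹ-closed

    ~-sym : ∀ {x y} → x ~ y → y ~ x
    ~-sym {x} {y} x~y = P.resp-≈ᴹ (begin
      -ᴹ (x +ᴹ -ᴹ y)       ≈⟨ ⁻¹-∙-comm x (-ᴹ y) ⟨
      -ᴹ x +ᴹ -ᴹ (-ᴹ y)    ≈⟨ +ᴹ-congˡ (-ᴹ-involutive y) ⟩
      -ᴹ x +ᴹ y            ≈⟨ +ᴹ-comm (-ᴹ x) y ⟩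
      y +ᴹ -ᴹ x            ∎) (P.-ᴹ-closed x~y)

    ~-trans : ∀ {x y z} → x ~ y → y ~ z → x ~ z
    ~-trans {x} {y} {z} x~y y~z = P.resp-≈ᴹ (begin
      (x +ᴹ -ᴹ y) +ᴹ (y +ᴹ -ᴹ z)   ≈⟨ +ᴹ-assoc x (-ᴹ y) (y +ᴹ -ᴹ z) ⟩
      x +ᴹ (-ᴹ y +ᴹ (y +ᴹ -ᴹ z))   ≈⟨ +ᴹ-congˡ (+ᴹ-assoc (-ᴹ y) y (-ᴹ z)) ⟨
      x +ᴹ ((-ᴹ y +ᴹ y) +ᴹ -ᴹ z)   ≈⟨ +ᴹ-congˡ (+ᴹ-congʳ (-ᴹ‿inverseˡ y)) ⟩
      x +ᴹ (0ᴹ +ᴹ -ᴹ z)            ≈⟨ +ᴹ-congˡ (+ᴹ-identityˡ (-ᴹ z)) ⟩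
      x +ᴹ -ᴹ z                    ∎) (P.+ᴹ-closed x~y y~z)

    ~-+-cong : ∀ {x y u v} → x ~ y → u ~ v → x +ᴹ u ~ y +ᴹ v
    ~-+-cong {x} {y} {u} {v} x~y u~v = P.resp-≈ᴹ (begin
      (x +ᴹ -ᴹ y) +ᴹ (u +ᴹ -ᴹ v)   ≈⟨ interchange x (-ᴹ y) u (-ᴹ v) ⟩
      (x +ᴹ u) +ᴹ (-ᴹ y +ᴹ -ᴹ v)   ≈⟨ +ᴹ-congˡ (⁻¹-∙-comm y v) ⟩
      (x +ᴹ u) +ᴹ -ᴹ (y +ᴹ v)      ∎) (P.+ᴹ-closed x~y u~v)

    ~-*ₗ-cong : ∀ r {x y} → x ~ y → r *ₗ x ~ r *ₗ y
    ~-*ₗ-cong r {x} {y} x~y = P.resp-≈ᴹ (begin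
      r *ₗ (x +ᴹ -ᴹ y)         ≈⟨ *ₗ-distribˡ r x (-ᴹ y) ⟩
      r *ₗ x +ᴹ r *ₗ (-ᴹ y)    ≈⟨ +ᴹ-congˡ (inverseʳ-uniqueᴹ (r *ₗ y) (r *ₗ (-ᴹ y)) (begin
          r *ₗ y +ᴹ r *ₗ (-ᴹ y)  ≈⟨ *ₗ-distribˡ r y (-ᴹ y) ⟨
          r *ₗ (y +ᴹ -ᴹ y)       ≈⟨ *ₗ-congˡ (-ᴹ‿inverseʳ y) ⟩
          r *ₗ 0ᴹ                ≈⟨ *ₗ-zeroʳ r ⟩
          0ᴹ                     ∎)) ⟩
      r *ₗ x +ᴹ -ᴹ (r *ₗ y)    ∎) (P.*ₗ-closed r x~y)

------------------------------------------------------------------------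
-- Finite-dimensional modules, torsion classes and bricks

module RepresentationTheory {ℓ : Level} {k : Field ℓ} (A : FiniteDimensionalAlgebra k) where

  open FiniteDimensionalAlgebra A using (algebra; ring)
  open Modules ring public

  record FDModule : Set (suc ℓ) where
    constructor fdModule
    field
      mod               : LeftModule ring ℓ ℓ
      finiteDimensional : FiniteDimensional algebra mod

  open FDModule

  zeroModule : FDModule
  zeroModule = fdModule Zero.leftModule (0 , (λ ()) , λ _ → (λ ()) , tt)

  -- Orthogonality and filtrations quantify over all modules, so the predicates
  -- they define take values in Set (suc ℓ).
  Class : Set (suc (suc ℓ))
  Class = Pred FDModule (suc ℓ)

  record Filtration {q : Level} (𝒬 : Pred FDModule q) (M : FDModule) : Set (suc ℓ ⊔ q) where
    open LeftModule (mod M) using (_≈ᴹ_; 0ᴹ)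
    open Submodule using (member)
    field
      length : ℕ
      stage  : Fin (sucℕ length) → Submodule (mod M)
      bottom : ∀ {x} → x ∈ member (stage fzero) → x ≈ᴹ 0ᴹ
      top    : ∀ x → x ∈ member (stage (fromℕ length))
      mono   : ∀ i → member (stage (inject₁ i)) ⊆ member (stage (fsuc i))
      factor : ∀ i → ∃[ Q ] Q ∈ 𝒬 × (stage (fsuc i) / stage (inject₁ i)) ≅ mod Q

  _^⊥ᴹ ⊥ᴹ^_ : Class → Class
  (𝒯 ^⊥ᴹ) M = ∀ {L} → L ∈ 𝒯 → HomIsZero (mod L) (mod M)
  (⊥ᴹ^ ℱ) L = ∀ {M} → M ∈ ℱ → HomIsZero (mod L) (mod M)

  record IsExtensionClosedSubcategory (𝒞 : Class) : Set (suc ℓ) where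
    field
      resp-≅     : ∀ {M N} → mod M ≅ mod N → M ∈ 𝒞 → N ∈ 𝒞
      zero       : zeroModule ∈ 𝒞
      extensions : ∀ {L M N} → ShortExact (mod L) (mod M) (mod N) → L ∈ 𝒞 → N ∈ 𝒞 → M ∈ 𝒞

  record IsTorsionClass (𝒯 : Class) : Set (suc ℓ) where
    field
      isExtensionClosed : IsExtensionClosedSubcategory 𝒯
      quotients         : ∀ {M N} → QuotientOf (mod M) (mod N) → M ∈ 𝒯 → N ∈ 𝒯
    open IsExtensionClosedSubcategory isExtensionClosed public

  record IsTorsionFreeClass (ℱ : Class) : Set (suc ℓ) where
    field
      isExtensionClosed : IsExtensionClosedSubcategory ℱ
      submodules        : ∀ {M N} → SubmoduleOf (mod M) (mod N) → M ∈ ℱ → N ∈ ℱ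
    open IsExtensionClosedSubcategory isExtensionClosed public

  record IsTorsionPair (𝒯 ℱ : Class) : Set (suc ℓ) where
    field
      isTorsionClass     : IsTorsionClass 𝒯
      isTorsionFreeClass : IsTorsionFreeClass ℱ
      ℱ≐𝒯^⊥               : ℱ ≐ 𝒯 ^⊥ᴹ
      𝒯≐⊥^ℱ               : 𝒯 ≐ ⊥ᴹ^ ℱ

  -- An element of tors(A) is a torsion class 𝒯; the torsion pair it is
  -- identified with is (𝒯 , ℱ) with ℱ the class right orthogonal to 𝒯.
  record TorsionClass : Set (suc (suc ℓ)) where
    constructor torsionClass
    field
      𝒯              : Class
      isTorsionClass : IsTorsionClass 𝒯
    ℱ : Class
    ℱ = 𝒯 ^⊥ᴹ

  tors : Poset (suc (suc ℓ)) (suc ℓ) (suc ℓ)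
  tors = On.poset (⊆-poset FDModule (suc ℓ)) TorsionClass.𝒯

  -- IsDivisionRing contains 1 ≉ 0, which makes a brick nonzero.
  record Brick : Set (suc ℓ) where
    field
      fd      : FDModule
      isBrick : IsDivisionRing (endRing (mod fd))
    open FDModule fd public

  open Brick using (fd)

  Bricks : Setoid (suc ℓ) ℓ
  Bricks = record
    { Carrier       = Brick
    ; _≈_           = _≅_ on Brick.mod
    ; isEquivalence = On.isEquivalence Brick.mod ≅-isEquivalence
    }

  infix 4 _⟶_ _↠_ _↪_

  _⟶_ : Rel Brick ℓ
  L ⟶ M = HomIsNonzero (Brick.mod L) (Brick.mod M)

  _↠_ : Rel Brick (suc ℓ)
  L ↠ M = Filtration (λ Q → QuotientOf (Brick.mod L) (mod Q)) (fd M)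

  _↪_ : Rel Brick (suc ℓ)
  L ↪ M = Filtration (λ Q → SubmoduleOf (Brick.mod M) (mod Q)) (fd L)

  _∩Bricks : Class → Pred Brick (suc ℓ)
  (𝒞 ∩Bricks) B = fd B ∈ 𝒞

  FilteredByQuotientsOf FilteredBySubmodulesOf : Pred Brick (suc ℓ) → Class
  FilteredByQuotientsOf  X = Filtration (λ Q → ∃[ B ] B ∈ X × QuotientOf  (Brick.mod B) (mod Q))
  FilteredBySubmodulesOf Y = Filtration (λ Q → ∃[ B ] B ∈ Y × SubmoduleOf (Brick.mod B) (mod Q))

  open FactorizationSystems Bricks using (IsMaximalOrthogonalPair; MaximalOrthogonalPair; pair; Pairs)
  open MaximalOrthogonalPair using (X; Y)
  open TorsionClass using (𝒯; ℱ)

  BrickPairs : Poset (suc (suc ℓ)) (suc ℓ) (suc ℓ)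
  BrickPairs = Pairs _⟶_ (suc ℓ)

  RestrictionsAreMaximal : Set (suc (suc ℓ))
  RestrictionsAreMaximal =
    ∀ t → IsMaximalOrthogonalPair _⟶_ (𝒯 t ∩Bricks) (ℱ t ∩Bricks)

  FilteredClassesAreTorsionPairs : Set (suc (suc ℓ))
  FilteredClassesAreTorsionPairs =
    (p : MaximalOrthogonalPair _⟶_ (suc ℓ)) →
    IsTorsionPair (FilteredByQuotientsOf (X p)) (FilteredBySubmodulesOf (Y p))

  restrict : RestrictionsAreMaximal → Poset.Carrier tors → Poset.Carrier BrickPairs
  restrict isMaximal t = pair (𝒯 t ∩Bricks) (ℱ t ∩Bricks) (isMaximal t)

  -- The torsion-free class of the result is by definition right orthogonal to
  -- its torsion class; ℱ≐𝒯^⊥ says that it is FilteredBySubmodulesOf (Y p).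
  extend : FilteredClassesAreTorsionPairs → Poset.Carrier BrickPairs → Poset.Carrier tors
  extend isTorsionPair p =
    torsionClass (FilteredByQuotientsOf (X p)) (IsTorsionPair.isTorsionClass (isTorsionPair p))

  IsOrderIso : (Poset.Carrier tors → Poset.Carrier BrickPairs) → Set (suc (suc ℓ))
  IsOrderIso = IsOrderIsomorphism tors._≈_ pairs._≈_ tors._≤_ pairs._≤_
    where
    module tors  = Poset tors
    module pairs = Poset BrickPairs

  AreInverse : (Poset.Carrier tors → Poset.Carrier BrickPairs) →
               (Poset.Carrier BrickPairs → Poset.Carrier tors) → Set (suc (suc ℓ))
  AreInverse = Inverseᵇ (Poset._≈_ tors) (Poset._≈_ BrickPairs)

open FactorizationSystems public using (IsFactorizationSystem; IsTwoAcyclic)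
open RepresentationTheory public
  using ( Bricks; _⟶_; _↠_; _↪_; RestrictionsAreMaximal; FilteredClassesAreTorsionPairs
        ; restrict; extend; IsOrderIso; AreInverse)

{-# OPTIONS --safe #-}
module Submission where

-- Everything is read off from vanishing of Hom.  Greedily enlarging (or cutting
-- down) a submodule shows that the modules filtered by quotients of 𝒞 are exactly
-- ⊥(𝒞^⊥), and those filtered by submodules of 𝒞 exactly (⊥𝒞)^⊥; so L ↠ M means
-- that Hom(L,N) = 0 implies Hom(M,N) = 0, dually for ↪.  Bricks detect nonzero
-- maps: if L lies in a torsion class 𝒯 and f : L → N is nonzero, but L has a
-- nonzero nonsurjective endomorphism with image I, then f is nonzero on I or
-- induces a nonzero map on L / I; both are quotients of L, hence in 𝒯, and
-- smaller, so eventually a brick of 𝒯 has a nonzero map to N (dually for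
-- torsion-free classes).  In the same way a nonzero module in 𝒯 ∩ ℱ yields a
-- brick there, which applied to the image of L → M factors it as L ↠ B ↪ M.

open import Level using (Level; suc; _⊔_; Lift; lift; lower)
open import Axiom.ExcludedMiddle using (ExcludedMiddle)
open import Algebra.Bundles using (Ring; CommutativeMonoid)
open import Algebra.Module.Bundles using (LeftModule)
import Algebra.Definitions.RawMonoid as RawMonoidDefinitions
open import Algebra.Module.Morphism.Structures using (module LeftModuleMorphisms)
import Algebra.Module.Morphism.Construct.Composition as Composition
import Algebra.Module.Morphism.Construct.Identity as Identity
open import Algebra.Morphism.Structures using (module RingMorphisms)
import Algebra.Properties.AbelianGroup as AbelianGroupProperties
import Algebra.Properties.CommutativeSemigroup as CommutativeSemigroupProperties
open import Data.Empty using (⊥-elim)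
open import Data.Fin.Base using (Fin; inject₁; fromℕ) renaming (zero to fzero; suc to fsuc)
open import Data.Fin.Induction using (<-weakInduction; >-weakInduction)
open import Data.Nat.Base using (ℕ) renaming (suc to sucℕ)
open import Data.Product.Base using (_×_; Σ-syntax; ∃-syntax; _,_; proj₁; proj₂)
open import Data.Sum.Base using (_⊎_; inj₁; inj₂)
open import Data.Vec.Functional using (_∷_; tail; head)
open import Data.Unit.Polymorphic using (⊤; tt)
open import Function.Base using (case_of_)
open import Function.Bundles using (Equivalence; mk⇔)
open import Relation.Binary.PropositionalEquality using (_≡_; refl)
open import Relation.Binary.Bundles using (Poset)
open import Relation.Binary.Structures using (IsEquivalence)
open import Relation.Nullary using (¬_; yes; no)
open import Relation.Nullary.Decidable using (decidable-stable; map′)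
open import Relation.Unary using (Pred; _∈_; _≐_) renaming (_⊆_ to _⊆₁_)
import Relation.Binary.Reasoning.Setoid as SetoidReasoning
open import Defs using
  ( Field; Algebra; FiniteDimensionalAlgebra; IsDivisionRing; IsFactorizationSystem; IsTwoAcyclic
  ; module FactorizationSystems; module Modules; module RepresentationTheory)

-- No dimension function appears. Size is the length of some spanning family, and every descent
-- rests on two facts: a proper submodule, and a quotient that kills a nonzero element, are spanned
-- by strictly fewer elements. The obstacle on the side of factorization systems is that `Fact`
-- tests only against bricks, whereas `↠` and `↪` amount to conditions on Hom to or from arbitrary
-- modules. Detection by bricks closes this gap, because the modules receiving no nonzero map from a
-- fixed L form a torsion-free class, and dually. For pairs the same principle is combined with
-- maximality, which turns a brick orthogonal to Y into a member of X. Two-acyclicity comes from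
-- bijectivity of nonzero endomorphisms of bricks, applied to composites that leave a brick and
-- return to it. Excluded middle is taken one level up because the greedy steps ask whether some
-- module of a class admits a nonzero map, a question that ranges over a large type.

lowerEM : ∀ {ℓ} → ExcludedMiddle (suc ℓ) → ExcludedMiddle ℓ
lowerEM {ℓ} em {P} = map′ lower lift (em {Lift (suc ℓ) P})

-- Linear algebra over k: lengths of spanning families.

module LinearAlgebra {ℓ} (em : ExcludedMiddle ℓ) (k : Field ℓ) (V : LeftModule (Field.ring k) ℓ ℓ) where

  private module k = Field k
  open LeftModule V
  open Modules k.ring using (Submodule)
  open RawMonoidDefinitions +ᴹ-rawMonoid using (sum)
  open CommutativeMonoid +ᴹ-commutativeMonoid using () renaming (commutativeSemigroup to +ᴹ-commutativeSemigroup)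
  open AbelianGroupProperties +ᴹ-abelianGroup using (//-rightDividesˡ; //-rightDividesʳ; ⁻¹-∙-comm)
  open CommutativeSemigroupProperties +ᴹ-commutativeSemigroup using (interchange)
  open SetoidReasoning ≈ᴹ-setoid
  open Submodule

  lincomb : ∀ {n} → (Fin n → k.Carrier) → (Fin n → Carrierᴹ) → Carrierᴹ
  lincomb c v = sum (λ i → c i *ₗ v i)

  lincomb-+ : ∀ {n} (c d : Fin n → k.Carrier) (v : Fin n → Carrierᴹ) →
              lincomb c v +ᴹ lincomb d v ≈ᴹ lincomb (λ i → c i k.+ d i) v
  lincomb-+ {0}      c d v = +ᴹ-identityˡ 0ᴹ
  lincomb-+ {sucℕ n} c d v = begin
    (head c *ₗ head v +ᴹ lincomb (tail c) (tail v)) +ᴹ (head d *ₗ head v +ᴹ lincomb (tail d) (tail v))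
      ≈⟨ interchange _ _ _ _ ⟩
    (head c *ₗ head v +ᴹ head d *ₗ head v) +ᴹ (lincomb (tail c) (tail v) +ᴹ lincomb (tail d) (tail v))
      ≈⟨ +ᴹ-cong (≈ᴹ-sym (*ₗ-distribʳ _ _ _)) (lincomb-+ (tail c) (tail d) (tail v)) ⟩
    _ ∎

  lincomb-*ₗ : ∀ {n} a (c : Fin n → k.Carrier) (v : Fin n → Carrierᴹ) →
               a *ₗ lincomb c v ≈ᴹ lincomb (λ i → a k.* c i) v
  lincomb-*ₗ {0}      a c v = *ₗ-zeroʳ a
  lincomb-*ₗ {sucℕ n} a c v = ≈ᴹ-trans (*ₗ-distribˡ a _ _)
    (+ᴹ-cong (≈ᴹ-sym (*ₗ-assoc _ _ _)) (lincomb-*ₗ a (tail c) (tail v)))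

  lincomb-0 : ∀ {n} (v : Fin n → Carrierᴹ) → lincomb (λ _ → k.0#) v ≈ᴹ 0ᴹ
  lincomb-0 {0}      v = ≈ᴹ-refl
  lincomb-0 {sucℕ n} v = ≈ᴹ-trans (+ᴹ-cong (*ₗ-zeroˡ _) (lincomb-0 (tail v))) (+ᴹ-identityˡ 0ᴹ)

  span : ∀ {n} → (Fin n → Carrierᴹ) → Submodule V
  span v = record
    { member    = λ x → ∃[ c ] x ≈ᴹ lincomb c v
    ; resp-≈ᴹ   = λ x≈y (c , x≈) → c , ≈ᴹ-trans (≈ᴹ-sym x≈y) x≈
    ; 0ᴹ-closed = _ , ≈ᴹ-sym (lincomb-0 v)
    ; +ᴹ-closed = λ (c , x≈) (d , y≈) → _ , ≈ᴹ-trans (+ᴹ-cong x≈ y≈) (lincomb-+ c d v)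
    ; *ₗ-closed = λ a (c , x≈) → _ , ≈ᴹ-trans (*ₗ-congˡ x≈) (lincomb-*ₗ a c v)
    }

  _⊆ˢ_ : Submodule V → Submodule V → Set ℓ
  U ⊆ˢ W = ∀ {x} → member U x → member W x

  infix 4 _⊆ˢ_

  _∩_ : Submodule V → Submodule V → Submodule V
  U ∩ W = record
    { member    = λ x → member U x × member W x
    ; resp-≈ᴹ   = λ x≈y (u , w) → resp-≈ᴹ U x≈y u , resp-≈ᴹ W x≈y w
    ; 0ᴹ-closed = 0ᴹ-closed U , 0ᴹ-closed W
    ; +ᴹ-closed = λ (u , w) (u′ , w′) → +ᴹ-closed U u u′ , +ᴹ-closed W w w′
    ; *ₗ-closed = λ a (u , w) → *ₗ-closed U a u , *ₗ-closed W a w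
    }

  lincomb-closed : ∀ {n} (U : Submodule V) c (v : Fin n → Carrierᴹ) → (∀ i → member U (v i)) → member U (lincomb c v)
  lincomb-closed {0}      U c v v∈ = 0ᴹ-closed U
  lincomb-closed {sucℕ n} U c v v∈ =
    +ᴹ-closed U (*ₗ-closed U _ (v∈ fzero)) (lincomb-closed U (tail c) (tail v) (λ i → v∈ (fsuc i)))

  -- Gaussian elimination of the first coordinate, with w as pivot.
  eliminate : ∀ {n} (v : Fin (sucℕ n) → Carrierᴹ) {w x} c → w ≈ᴹ lincomb c v → ¬ (head c k.≈ k.0#) →
              member (span v) x → ∃[ a ] member (span (tail v)) (x +ᴹ -ᴹ (a *ₗ w))
  eliminate v {w} {x} c w≈ c₀≉0 (d , x≈) with IsDivisionRing.invertible k.isDivisionRing (head c) c₀≉0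
  ... | e , ec₀≈1 , _ = a , resp-≈ᴹ S (≈ᴹ-sym (begin
          x +ᴹ -ᴹ (a *ₗ w)                                   ≈⟨ +ᴹ-cong x≈ (-ᴹ‿cong aw≈) ⟩
          (head d *ₗ head v +ᴹ r) +ᴹ -ᴹ (head d *ₗ head v +ᴹ a *ₗ s)
            ≈⟨ +ᴹ-congˡ (⁻¹-∙-comm _ _) ⟨
          (head d *ₗ head v +ᴹ r) +ᴹ (-ᴹ (head d *ₗ head v) +ᴹ -ᴹ (a *ₗ s))
            ≈⟨ interchange _ _ _ _ ⟩
          (head d *ₗ head v +ᴹ -ᴹ (head d *ₗ head v)) +ᴹ (r +ᴹ -ᴹ (a *ₗ s))
            ≈⟨ +ᴹ-congʳ (-ᴹ‿inverseʳ _) ⟩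
          0ᴹ +ᴹ (r +ᴹ -ᴹ (a *ₗ s))                             ≈⟨ +ᴹ-identityˡ _ ⟩
          r +ᴹ -ᴹ (a *ₗ s)                                     ∎))
        (+ᴹ-closed S (_ , ≈ᴹ-refl) (Modules.Submodule.-ᴹ-closed S (*ₗ-closed S a (_ , ≈ᴹ-refl))))
    where
    S = span (tail v)
    a = head d k.* e
    r = lincomb (tail d) (tail v)
    s = lincomb (tail c) (tail v)
    aw≈ : a *ₗ w ≈ᴹ head d *ₗ head v +ᴹ a *ₗ s
    aw≈ = begin
      a *ₗ w                                      ≈⟨ *ₗ-congˡ w≈ ⟩
      a *ₗ (head c *ₗ head v +ᴹ s)                ≈⟨ *ₗ-distribˡ a _ s ⟩
      a *ₗ (head c *ₗ head v) +ᴹ a *ₗ s           ≈⟨ +ᴹ-congʳ (*ₗ-assoc a (head c) (head v)) ⟨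
      (a k.* head c) *ₗ head v +ᴹ a *ₗ s
        ≈⟨ +ᴹ-congʳ (*ₗ-congʳ (k.trans (k.*-assoc _ _ _) (k.trans (k.*-congˡ ec₀≈1) (k.*-identityʳ _)))) ⟩
      head d *ₗ head v +ᴹ a *ₗ s                  ∎

  Generated : ℕ → Submodule V → Set ℓ
  Generated n U = Σ[ w ∈ (Fin n → Carrierᴹ) ] (∀ i → member U (w i)) × U ⊆ˢ span w

  -- The bound is an equation, so that matching on `refl` exposes `m` as a structural predecessor of
  -- `n` in later recursions.
  GeneratedBelow : ℕ → Submodule V → Set ℓ
  GeneratedBelow n U = ∃[ m ] n ≡ sucℕ m × Generated m U

  generated-step : ∀ {n} {U : Submodule V} → Generated n U → Generated (sucℕ n) U
  generated-step {U = U} (w , w∈ , U⊆) = 0ᴹ ∷ w , (λ { fzero → 0ᴹ-closed U ; (fsuc i) → w∈ i }) , λ x∈ →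
    let c , x≈ = U⊆ x∈ in k.0# ∷ c , ≈ᴹ-trans x≈ (≈ᴹ-sym (≈ᴹ-trans (+ᴹ-congʳ (*ₗ-zeroˡ _)) (+ᴹ-identityˡ _)))

  generated-below : ∀ {n} {U : Submodule V} → GeneratedBelow n U → Generated n U
  generated-below {U = U} (_ , refl , g) = generated-step {U = U} g

  -- Induction on `n` by elimination: an element of U with nonzero first coordinate serves as pivot,
  -- and what remains of U is its intersection with the span of `tail v`. The dichotomy yields
  -- strict descent: when `v` spans V, a proper U cannot contain all of `v`, hence needs fewer
  -- generators.
  subspace-generated : ∀ {n} (v : Fin n → Carrierᴹ) (U : Submodule V) → U ⊆ˢ span v →
                       (∀ i → member U (v i)) ⊎ GeneratedBelow n U
  subspace-generated {0}      v U U⊆ = inj₁ λ ()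
  subspace-generated {sucℕ n} v U U⊆ with em {∃[ c ] ¬ (head c k.≈ k.0#) × member U (lincomb c v)}
  -- Without a pivot, U lies in the span of the `n` vectors of `tail v`, which already saves one
  -- generator.
  ... | no ¬pivot = inj₂ (n , refl , generated)
    where
    U⊆tail : U ⊆ˢ span (tail v)
    U⊆tail x∈ with U⊆ x∈
    ... | c , x≈ = tail c , ≈ᴹ-trans x≈ (≈ᴹ-trans (+ᴹ-congʳ (≈ᴹ-trans (*ₗ-congʳ c₀≈0) (*ₗ-zeroˡ _))) (+ᴹ-identityˡ _))
      where
      c₀≈0 : head c k.≈ k.0#
      c₀≈0 = decidable-stable em (λ c₀≉0 → ¬pivot (c , c₀≉0 , resp-≈ᴹ U x≈ x∈))
    generated : Generated n U
    generated with subspace-generated (tail v) U U⊆tail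
    ... | inj₁ v∈ = tail v , v∈ , U⊆tail
    ... | inj₂ g  = generated-below {U = U} g
  ... | yes (c , c₀≉0 , w∈) with subspace-generated (tail v) (U ∩ span (tail v)) proj₂
  ...   | inj₁ v∈ = inj₁ λ { fzero → v₀∈ ; (fsuc i) → proj₁ (v∈ i) }
    where
    s = lincomb (tail c) (tail v)
    -- As the tail lies in U, `head v` is recovered from the pivot by removing `s` and dividing by
    -- the first coefficient.
    v₀∈ : member U (head v)
    v₀∈ with IsDivisionRing.invertible k.isDivisionRing (head c) c₀≉0
    ... | e , ec₀≈1 , _ = resp-≈ᴹ U (begin
            e *ₗ ((head c *ₗ head v +ᴹ s) +ᴹ -ᴹ s)  ≈⟨ *ₗ-congˡ (//-rightDividesʳ s _) ⟩
            e *ₗ (head c *ₗ head v)                 ≈⟨ *ₗ-assoc e _ _ ⟨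
            (e k.* head c) *ₗ head v                ≈⟨ *ₗ-congʳ ec₀≈1 ⟩
            k.1# *ₗ head v                          ≈⟨ *ₗ-identityˡ _ ⟩
            head v                                  ∎)
          (*ₗ-closed U e (+ᴹ-closed U w∈ (Modules.Submodule.-ᴹ-closed U
            (lincomb-closed U (tail c) (tail v) (λ i → proj₁ (v∈ i))))))
  -- The intersection already saves a generator, so adding the pivot stays below the bound.
  ...   | inj₂ (m , refl , u , u∈ , spanned) = inj₂ (_ , refl , w ∷ u ,
          (λ { fzero → w∈ ; (fsuc i) → proj₁ (u∈ i) }) , λ {x} x∈ →
          let a , x-aw∈ = eliminate v c ≈ᴹ-refl c₀≉0 (U⊆ x∈)
              d , x-aw≈ = spanned (+ᴹ-closed U x∈ (Modules.Submodule.-ᴹ-closed U (*ₗ-closed U a w∈)) , x-aw∈)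
          in a ∷ d , (begin
            x                                ≈⟨ //-rightDividesˡ (a *ₗ w) x ⟨
            (x +ᴹ -ᴹ (a *ₗ w)) +ᴹ a *ₗ w     ≈⟨ +ᴹ-comm _ _ ⟩
            a *ₗ w +ᴹ (x +ᴹ -ᴹ (a *ₗ w))     ≈⟨ +ᴹ-congˡ x-aw≈ ⟩
            a *ₗ w +ᴹ lincomb d u            ∎))
    where
    w = lincomb c v

  -- A nonzero `x` in U is a relation among the `v i` modulo U, so the first vector with nonzero
  -- coefficient can be discarded. With U the kernel of a surjection this gives strict descent for
  -- quotients.
  span-modulo : ∀ {n} (v : Fin n → Carrierᴹ) (U : Submodule V) {x} → member (span v) x → member U x → ¬ (x ≈ᴹ 0ᴹ) →
                ∃[ m ] n ≡ sucℕ m × Σ[ u ∈ (Fin m → Carrierᴹ) ]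
                  (∀ {y} → member (span v) y → ∃[ z ] ∃[ t ] member (span u) z × member U t × y ≈ᴹ z +ᴹ t)
  span-modulo {0}      v U (_ , x≈0) x∈ x≉0 = ⊥-elim (x≉0 x≈0)
  span-modulo {sucℕ n} v U {x} (c , x≈) x∈ x≉0 with em {head c k.≈ k.0#}
  ... | no c₀≉0 = n , refl , tail v , λ {y} y∈ →
        let a , y-ax∈ = eliminate v c x≈ c₀≉0 y∈
        in _ , _ , y-ax∈ , *ₗ-closed U a x∈ , ≈ᴹ-sym (//-rightDividesˡ (a *ₗ x) y)
  ... | yes c₀≈0 with span-modulo (tail v) U
                        (tail c , ≈ᴹ-trans x≈ (≈ᴹ-trans (+ᴹ-congʳ (≈ᴹ-trans (*ₗ-congʳ c₀≈0) (*ₗ-zeroˡ _))) (+ᴹ-identityˡ _)))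
                        x∈ x≉0
  ...   | m , refl , u , spanned = sucℕ m , refl , head v ∷ u , λ (d , y≈) →
          let z , t , (f , z≈) , t∈ , r≈ = spanned (tail d , ≈ᴹ-refl)
          in head d *ₗ head v +ᴹ z , t , (head d ∷ f , +ᴹ-congˡ z≈) , t∈ ,
             ≈ᴹ-trans y≈ (≈ᴹ-trans (+ᴹ-congˡ r≈) (≈ᴹ-sym (+ᴹ-assoc _ _ _)))

-- Homomorphisms, submodules and subquotients over a ring.

module Homomorphisms {ℓ} (R : Ring ℓ ℓ) where

  open Modules R
  open Hom
  open Submodule
  open LeftModule using (Carrierᴹ; 0ᴹ; ≈ᴹ-refl; ≈ᴹ-sym; ≈ᴹ-trans; ≈ᴹ-setoid)

  private
    variable
      L M N D : LeftModule R ℓ ℓ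

    infix 4 _∋_≈_
    _∋_≈_ : (M : LeftModule R ℓ ℓ) → Carrierᴹ M → Carrierᴹ M → Set ℓ
    _∋_≈_ = LeftModule._≈ᴹ_

  infixr 9 _∘ʰ_

  _∘ʰ_ : Hom M N → Hom L M → Hom L N
  _∘ʰ_ {N = N} g f = record
    { ⟦_⟧    = λ x → ⟦ g ⟧ (⟦ f ⟧ x)
    ; isHomo = Composition.isLeftModuleHomomorphism (≈ᴹ-trans N) (isHomo f) (isHomo g)
    }

  idʰ : Hom M M
  idʰ {M} = record
    { ⟦_⟧    = λ x → x
    ; isHomo = Identity.isLeftModuleHomomorphism (LeftModule.rawLeftModule M) (≈ᴹ-refl M)
    }

  module _ {M : LeftModule R ℓ ℓ} where
    open AbelianGroupProperties (LeftModule.+ᴹ-abelianGroup M) public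
      using () renaming (x∙y⁻¹≈ε⇒x≈y to x-y≈0⇒x≈y; x≈y⇒x∙y⁻¹≈ε to x≈y⇒x-y≈0)

  homo-minus : (f : Hom M N) → ∀ x y → N ∋ ⟦ f ⟧ (LeftModule._+ᴹ_ M x (LeftModule.-ᴹ_ M y))
                                       ≈ LeftModule._+ᴹ_ N (⟦ f ⟧ x) (LeftModule.-ᴹ_ N (⟦ f ⟧ y))
  homo-minus {N = N} f x y = ≈ᴹ-trans N (+ᴹ-homo f x _) (LeftModule.+ᴹ-congˡ N (-ᴹ-homo f y))

  kernel-injective : (f : Hom M N) → (∀ x → N ∋ ⟦ f ⟧ x ≈ 0ᴹ N → M ∋ x ≈ 0ᴹ M) → IsInjective f
  kernel-injective {M} {N} f ker {x} {y} fx≈fy = x-y≈0⇒x≈y {M} x y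
    (ker _ (≈ᴹ-trans N (homo-minus f x y) (x≈y⇒x-y≈0 {N} fx≈fy)))

  kernel-respects : (g : Hom M N) (h : Hom M D) → (∀ x → N ∋ ⟦ g ⟧ x ≈ 0ᴹ N → D ∋ ⟦ h ⟧ x ≈ 0ᴹ D) →
                    ∀ {x y} → N ∋ ⟦ g ⟧ x ≈ ⟦ g ⟧ y → D ∋ ⟦ h ⟧ x ≈ ⟦ h ⟧ y
  kernel-respects {M} {N} {D} g h ker {x} {y} gx≈gy = x-y≈0⇒x≈y {D} (⟦ h ⟧ x) (⟦ h ⟧ y)
    (≈ᴹ-trans D (≈ᴹ-sym D (homo-minus h x y))
      (ker _ (≈ᴹ-trans N (homo-minus g x y) (x≈y⇒x-y≈0 {N} gx≈gy))))

  surjective : (f : Hom M N) → (∀ y → ∃[ x ] N ∋ ⟦ f ⟧ x ≈ y) → IsSurjective f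
  surjective {N = N} f pre y = let x , fx≈y = pre y in x , λ z≈x → ≈ᴹ-trans N (⟦⟧-cong f z≈x) fx≈y

  preimage : (f : Hom M N) → IsSurjective f → ∀ y → ∃[ x ] N ∋ ⟦ f ⟧ x ≈ y
  preimage {M} f f-surj y = let x , fz≈y = f-surj y in x , fz≈y (≈ᴹ-refl M)

  -- The section `g⁻` is read off from the surjectivity proof. It need neither respect equality nor
  -- be linear; the kernel condition makes its composite with `h` do both.
  factor-through-surjection : (g : Hom M N) → IsSurjective g → (h : Hom M D) →
                              (∀ x → N ∋ ⟦ g ⟧ x ≈ 0ᴹ N → D ∋ ⟦ h ⟧ x ≈ 0ᴹ D) →
                              Σ[ h′ ∈ Hom N D ] ∀ x → D ∋ ⟦ h′ ⟧ (⟦ g ⟧ x) ≈ ⟦ h ⟧ x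
  factor-through-surjection {M} {N} {D} g g-surj h ker = h′ , λ x → respects (gg⁻ _)
    where
    module N = LeftModule N
    module D = LeftModule D
    g⁻ : N.Carrierᴹ → Carrierᴹ M
    g⁻ y = proj₁ (preimage g g-surj y)
    gg⁻ : ∀ y → N ∋ ⟦ g ⟧ (g⁻ y) ≈ y
    gg⁻ y = proj₂ (preimage g g-surj y)
    respects : ∀ {x y} → N ∋ ⟦ g ⟧ x ≈ ⟦ g ⟧ y → D ∋ ⟦ h ⟧ x ≈ ⟦ h ⟧ y
    respects = kernel-respects g h ker
    h′ : Hom N D
    h′ = record
      { ⟦_⟧    = λ y → ⟦ h ⟧ (g⁻ y)
      ; isHomo = mkIsHomo {N} {D}
          (λ y≈z → respects (N.≈ᴹ-trans (gg⁻ _) (N.≈ᴹ-trans y≈z (N.≈ᴹ-sym (gg⁻ _)))))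
          (λ y z → D.≈ᴹ-trans (respects (N.≈ᴹ-trans (gg⁻ _) (N.≈ᴹ-sym
            (N.≈ᴹ-trans (+ᴹ-homo g _ _) (N.+ᴹ-cong (gg⁻ y) (gg⁻ z)))))) (+ᴹ-homo h _ _))
          (λ r y → D.≈ᴹ-trans (respects (N.≈ᴹ-trans (gg⁻ _) (N.≈ᴹ-sym
            (N.≈ᴹ-trans (*ₗ-homo g _ _) (N.*ₗ-congˡ (gg⁻ y)))))) (*ₗ-homo h _ _))
      }

  factor-through-injection : (f : Hom L M) → IsInjective f → (h : Hom D M) →
                             (∀ d → ∃[ x ] M ∋ ⟦ f ⟧ x ≈ ⟦ h ⟧ d) →
                             Σ[ h′ ∈ Hom D L ] ∀ d → M ∋ ⟦ f ⟧ (⟦ h′ ⟧ d) ≈ ⟦ h ⟧ d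
  factor-through-injection {L} {M} {D} f f-inj h pre = h′ , λ d → proj₂ (pre d)
    where
    module M = LeftModule M
    ff⁻ : ∀ d → M ∋ ⟦ f ⟧ (proj₁ (pre d)) ≈ ⟦ h ⟧ d
    ff⁻ d = proj₂ (pre d)
    h′ : Hom D L
    h′ = record
      { ⟦_⟧    = λ d → proj₁ (pre d)
      ; isHomo = mkIsHomo {D} {L}
          (λ x≈y → f-inj (M.≈ᴹ-trans (ff⁻ _) (M.≈ᴹ-trans (⟦⟧-cong h x≈y) (M.≈ᴹ-sym (ff⁻ _)))))
          (λ x y → f-inj (M.≈ᴹ-trans (ff⁻ _) (M.≈ᴹ-trans (+ᴹ-homo h x y) (M.≈ᴹ-sym
            (M.≈ᴹ-trans (+ᴹ-homo f _ _) (M.+ᴹ-cong (ff⁻ x) (ff⁻ y)))))))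
          (λ r x → f-inj (M.≈ᴹ-trans (ff⁻ _) (M.≈ᴹ-trans (*ₗ-homo h r x) (M.≈ᴹ-sym
            (M.≈ᴹ-trans (*ₗ-homo f _ _) (M.*ₗ-congˡ (ff⁻ x)))))))
      }

  bijective⇒≅ : (f : Hom M N) → IsInjective f → IsSurjective f → M ≅ N
  bijective⇒≅ f f-inj f-surj = ⟦ f ⟧ , record
    { isLeftModuleMonomorphism = record { isLeftModuleHomomorphism = isHomo f ; injective = f-inj }
    ; surjective               = f-surj
    }

  ≅-sym : (M N : LeftModule R ℓ ℓ) → M ≅ N → N ≅ M
  ≅-sym M N = IsEquivalence.sym ≅-isEquivalence {M} {N}

  ≅⇒quotient : (M N : LeftModule R ℓ ℓ) → M ≅ N → QuotientOf M N
  ≅⇒quotient M N (f , F) = record { ⟦_⟧ = f ; isHomo = F.isLeftModuleHomomorphism } , F.surjective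
    where module F = LeftModuleMorphisms.IsLeftModuleIsomorphism F

  ≅⇒submodule : (M N : LeftModule R ℓ ℓ) → M ≅ N → SubmoduleOf N M
  ≅⇒submodule M N (f , F) = record { ⟦_⟧ = f ; isHomo = F.isLeftModuleHomomorphism } , F.injective
    where module F = LeftModuleMorphisms.IsLeftModuleIsomorphism F

  ∘-surjective : (g : Hom M N) (f : Hom L M) → IsSurjective g → IsSurjective f → IsSurjective (g ∘ʰ f)
  ∘-surjective {N = N} g f g-surj f-surj = surjective (g ∘ʰ f) λ z →
    let y , gy≈z = preimage g g-surj z
        x , fx≈y = preimage f f-surj y
    in x , ≈ᴹ-trans N (⟦⟧-cong g fx≈y) gy≈z

  zeroSubmodule wholeSubmodule : (M : LeftModule R ℓ ℓ) → Submodule M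
  zeroSubmodule M = record
    { member    = λ x → x ≈ᴹ 0ᴹ M
    ; resp-≈ᴹ   = λ x≈y x≈0 → ≈ᴹ-trans M (≈ᴹ-sym M x≈y) x≈0
    ; 0ᴹ-closed = ≈ᴹ-refl M
    ; +ᴹ-closed = λ x≈0 y≈0 → ≈ᴹ-trans M (+ᴹ-cong x≈0 y≈0) (+ᴹ-identityˡ _)
    ; *ₗ-closed = λ r x≈0 → ≈ᴹ-trans M (*ₗ-congˡ x≈0) (*ₗ-zeroʳ r)
    }
    where open LeftModule M using (_≈ᴹ_; +ᴹ-cong; +ᴹ-identityˡ; *ₗ-congˡ; *ₗ-zeroʳ)
  wholeSubmodule M = record
    { member    = λ _ → ⊤
    ; resp-≈ᴹ   = λ _ _ → tt
    ; 0ᴹ-closed = tt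
    ; +ᴹ-closed = λ _ _ → tt
    ; *ₗ-closed = λ _ _ → tt
    }

  preimageSubmodule : Hom M N → Submodule N → Submodule M
  preimageSubmodule {M} {N} f U = record
    { member    = λ x → member U (⟦ f ⟧ x)
    ; resp-≈ᴹ   = λ x≈y → resp-≈ᴹ U (⟦⟧-cong f x≈y)
    ; 0ᴹ-closed = resp-≈ᴹ U (≈ᴹ-sym N (0ᴹ-homo f)) (0ᴹ-closed U)
    ; +ᴹ-closed = λ x∈ y∈ → resp-≈ᴹ U (≈ᴹ-sym N (+ᴹ-homo f _ _)) (+ᴹ-closed U x∈ y∈)
    ; *ₗ-closed = λ r x∈ → resp-≈ᴹ U (≈ᴹ-sym N (*ₗ-homo f _ _)) (*ₗ-closed U r x∈)
    }

  kernel : Hom M N → Submodule M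
  kernel {N = N} f = preimageSubmodule f (zeroSubmodule N)

  image : Hom M N → Submodule N
  image {M} {N} f = record
    { member    = λ y → ∃[ x ] N ∋ ⟦ f ⟧ x ≈ y
    ; resp-≈ᴹ   = λ y≈z (x , fx≈y) → x , ≈ᴹ-trans N fx≈y y≈z
    ; 0ᴹ-closed = 0ᴹ M , 0ᴹ-homo f
    ; +ᴹ-closed = λ (x , fx≈) (y , fy≈) → _ , ≈ᴹ-trans N (+ᴹ-homo f x y) (LeftModule.+ᴹ-cong N fx≈ fy≈)
    ; *ₗ-closed = λ r (x , fx≈) → _ , ≈ᴹ-trans N (*ₗ-homo f r x) (LeftModule.*ₗ-congˡ N fx≈)
    }

  -- Both are instances of `_/_`, so the subquotient lemmas serve them too. The price is that
  -- equality in `sub N` reads x - y ≈ 0, whence the conversions by `x≈y⇒x-y≈0`.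
  sub quot : Submodule M → LeftModule R ℓ ℓ
  sub  {M} N = N / zeroSubmodule M
  quot {M} N = wholeSubmodule M / N

  incl : (N : Submodule M) → Hom (sub N) M
  incl {M} N = record
    { ⟦_⟧    = proj₁
    ; isHomo = mkIsHomo {sub N} {M} (λ {x} {y} → x-y≈0⇒x≈y {M} (proj₁ x) (proj₁ y)) (λ _ _ → ≈ᴹ-refl M) (λ _ _ → ≈ᴹ-refl M)
    }

  incl-injective : (N : Submodule M) → IsInjective (incl N)
  incl-injective {M} N = x≈y⇒x-y≈0 {M}

  sub-submodule : (N : Submodule M) → SubmoduleOf M (sub N)
  sub-submodule N = incl N , λ {x} {y} → incl-injective N {x} {y}

  corestrict : (U : Submodule M) (h : Hom D M) → (∀ d → member U (⟦ h ⟧ d)) → Hom D (sub U)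
  corestrict {M} U h h∈ = proj₁ (factor-through-injection (incl U) (λ {x} {y} → incl-injective U {x} {y}) h
    λ d → (⟦ h ⟧ d , h∈ d) , ≈ᴹ-refl M)

  _⊆_ : Submodule M → Submodule M → Set ℓ
  P ⊆ N = ∀ {x} → member P x → member N x

  infix 4 _⊆_

  subquotient-≈ : (N P : Submodule M) {x y : Carrierᴹ (N / P)} → M ∋ proj₁ x ≈ proj₁ y → N / P ∋ x ≈ y
  subquotient-≈ {M} N P x≈y = resp-≈ᴹ P (≈ᴹ-sym M (x≈y⇒x-y≈0 {M} x≈y)) (0ᴹ-closed P)

  minus-zero : ∀ {x} → M ∋ LeftModule._+ᴹ_ M x (LeftModule.-ᴹ_ M (0ᴹ M)) ≈ x
  minus-zero {M} = ≈ᴹ-trans M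
    (LeftModule.+ᴹ-congˡ M (AbelianGroupProperties.ε⁻¹≈ε (LeftModule.+ᴹ-abelianGroup M))) (LeftModule.+ᴹ-identityʳ M _)

  subquotient-zero⁺ : (N P : Submodule M) (x : Carrierᴹ (N / P)) → member P (proj₁ x) → N / P ∋ x ≈ 0ᴹ (N / P)
  subquotient-zero⁺ {M} N P x = resp-≈ᴹ P (≈ᴹ-sym M (minus-zero {M}))

  subquotient-zero⁻ : (N P : Submodule M) (x : Carrierᴹ (N / P)) → N / P ∋ x ≈ 0ᴹ (N / P) → member P (proj₁ x)
  subquotient-zero⁻ {M} N P x = resp-≈ᴹ P (minus-zero {M})

  proj : (N P : Submodule M) → Hom (sub N) (N / P)
  proj {M} N P = record
    { ⟦_⟧    = λ x → x
    ; isHomo = mkIsHomo {sub N} {N / P} (λ {x} {y} x≈y → subquotient-≈ N P {x} {y} (x-y≈0⇒x≈y {M} (proj₁ x) (proj₁ y) x≈y))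
        (λ x y → ≈ᴹ-refl (N / P) {LeftModule._+ᴹ_ (N / P) x y}) (λ r x → ≈ᴹ-refl (N / P) {LeftModule._*ₗ_ (N / P) r x})
    }

  proj-surjective : (N P : Submodule M) → IsSurjective (proj N P)
  proj-surjective N P = surjective (proj N P) λ y → y , ≈ᴹ-refl (N / P) {y}

  toQuot : (P : Submodule M) → Hom M (quot P)
  toQuot {M} P = record
    { ⟦_⟧    = λ x → x , tt
    ; isHomo = mkIsHomo {M} {quot P} (λ {x} {y} → subquotient-≈ (wholeSubmodule M) P {x , tt} {y , tt})
        (λ _ _ → ≈ᴹ-refl (quot P)) (λ _ _ → ≈ᴹ-refl (quot P))
    }

  toQuot-surjective : (P : Submodule M) → IsSurjective (toQuot P)
  toQuot-surjective P = surjective (toQuot P) λ (y , _) → y , ≈ᴹ-refl (quot P)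

  quot-quotient : (P : Submodule M) → QuotientOf M (quot P)
  quot-quotient P = toQuot P , toQuot-surjective P

  toImage : (f : Hom M N) → Hom M (sub (image f))
  toImage {N = N} f = corestrict (image f) f λ x → x , ≈ᴹ-refl N

  toImage-surjective : (f : Hom M N) → IsSurjective (toImage f)
  toImage-surjective {M} {N} f = surjective (toImage f) λ (y , x , fx≈y) →
    x , x≈y⇒x-y≈0 {N} fx≈y

  image-quotient : (f : Hom M N) → QuotientOf M (sub (image f))
  image-quotient f = toImage f , toImage-surjective f

  push : (N : Submodule M) → Submodule (sub N) → Submodule M
  push {M} N U = record
    { member    = λ x → Σ[ x∈ ∈ member N x ] member U (x , x∈)
    ; resp-≈ᴹ   = λ x≈y (x∈ , u) → resp-≈ᴹ N x≈y x∈ , resp-≈ᴹ U (x≈y⇒x-y≈0 {M} x≈y) u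
    ; 0ᴹ-closed = 0ᴹ-closed N , 0ᴹ-closed U
    ; +ᴹ-closed = λ (x∈ , u) (y∈ , w) → +ᴹ-closed N x∈ y∈ , +ᴹ-closed U u w
    ; *ₗ-closed = λ r (x∈ , u) → *ₗ-closed N r x∈ , *ₗ-closed U r u
    }

  push-quotient : (N : Submodule M) (U : Submodule (sub N)) → QuotientOf (sub U) (sub (push N U))
  push-quotient {M} N U = h , surjective h λ (y , y∈ , u) → ((y , y∈) , u) , x≈y⇒x-y≈0 {M} (≈ᴹ-refl M)
    where
    h : Hom (sub U) (sub (push N U))
    h = corestrict (push N U) (incl N ∘ʰ incl U) λ ((x , x∈) , u) → x∈ , u

  inclQuot : (N P : Submodule M) → Hom (N / P) (quot P)
  inclQuot {M} N P = record
    { ⟦_⟧    = λ (x , _) → x , tt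
    ; isHomo = mkIsHomo {N / P} {quot P} (λ x≈y → x≈y)
        (λ x y → ≈ᴹ-refl (N / P) {LeftModule._+ᴹ_ (N / P) x y}) (λ r x → ≈ᴹ-refl (N / P) {LeftModule._*ₗ_ (N / P) r x})
    }

  quot-mono : (P P′ : Submodule M) → P ⊆ P′ → Hom (quot P) (quot P′)
  quot-mono {M} P P′ P⊆P′ = proj₁ (factor-through-surjection (toQuot P) (toQuot-surjective P) (toQuot P′)
    λ x x∈ → subquotient-zero⁺ (wholeSubmodule M) P′ (x , tt) (P⊆P′ (subquotient-zero⁻ (wholeSubmodule M) P (x , tt) x∈)))

  sub-mono : (P P′ : Submodule M) → P ⊆ P′ → Hom (sub P) (sub P′)
  sub-mono P P′ P⊆P′ = corestrict P′ (incl P) λ (x , x∈) → P⊆P′ x∈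

  zero-after-surjection : (g : Hom M N) → IsSurjective g → (h : Hom N D) → (∀ x → D ∋ ⟦ h ⟧ (⟦ g ⟧ x) ≈ 0ᴹ D) → IsZero h
  zero-after-surjection {N = N} {D = D} g g-surj h hg≈0 y = let x , gx≈y = preimage g g-surj y in
    ≈ᴹ-trans D (⟦⟧-cong h (≈ᴹ-sym N gx≈y)) (hg≈0 x)

  zero-before-injection : (f : Hom L M) → IsInjective f → (h : Hom D L) → (∀ x → M ∋ ⟦ f ⟧ (⟦ h ⟧ x) ≈ 0ᴹ M) → IsZero h
  zero-before-injection {M = M} f f-inj h fh≈0 x = f-inj (≈ᴹ-trans M (fh≈0 x) (≈ᴹ-sym M (0ᴹ-homo f)))

  homIsZero-quotient : QuotientOf L N → HomIsZero L M → HomIsZero N M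
  homIsZero-quotient (g , g-surj) L⊥M h = zero-after-surjection g g-surj h (L⊥M (h ∘ʰ g))

  homIsZero-submodule : SubmoduleOf M N → HomIsZero L M → HomIsZero L N
  homIsZero-submodule (f , f-inj) L⊥M h = zero-before-injection f f-inj h (L⊥M (f ∘ʰ h))

  homIsZero-resp-source : (M N : LeftModule R ℓ ℓ) → M ≅ N → HomIsZero M D → HomIsZero N D
  homIsZero-resp-source M N M≅N = homIsZero-quotient (≅⇒quotient M N M≅N)

  homIsZero-resp-target : (M N : LeftModule R ℓ ℓ) → M ≅ N → HomIsZero D M → HomIsZero D N
  homIsZero-resp-target M N M≅N = homIsZero-submodule (≅⇒submodule N M (≅-sym M N M≅N))

  homIsZero-extension-source : ShortExact L M N → HomIsZero L D → HomIsZero N D → HomIsZero M D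
  homIsZero-extension-source {L} {M} {N} {D} E L⊥D N⊥D h x =
    let h′ , h′g≈h = factor-through-surjection g surj h λ y gy≈0 →
                       let z , fz≈y = Equivalence.to (exact y) gy≈0
                       in ≈ᴹ-trans D (⟦⟧-cong h (≈ᴹ-sym M fz≈y)) (L⊥D (h ∘ʰ f) z)
    in ≈ᴹ-trans D (≈ᴹ-sym D (h′g≈h x)) (N⊥D h′ _)
    where open ShortExact E renaming (surjective to surj)

  homIsZero-extension-target : ShortExact L M N → HomIsZero D L → HomIsZero D N → HomIsZero D M
  homIsZero-extension-target {L} {M} {N} {D} E D⊥L D⊥N h x =
    let h′ , fh′≈h = factor-through-injection f injective h λ d → Equivalence.to (exact (⟦ h ⟧ d)) (D⊥N (g ∘ʰ h) d)
    in ≈ᴹ-trans M (≈ᴹ-sym M (fh′≈h x)) (≈ᴹ-trans M (⟦⟧-cong f (D⊥L h′ x)) (0ᴹ-homo f))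
    where open ShortExact E

  sub-shortExact : (P P′ : Submodule M) → P ⊆ P′ → ShortExact (sub P) (sub P′) (P′ / P)
  sub-shortExact {M} P P′ P⊆P′ = record
    { f          = sub-mono P P′ P⊆P′
    ; g          = proj P′ P
    ; injective  = λ jx≈jy → jx≈jy
    ; surjective = proj-surjective P′ P
    ; exact      = λ y → mk⇔
        (λ y≈0 → (proj₁ y , subquotient-zero⁻ P′ P y y≈0) , x≈y⇒x-y≈0 {M} (≈ᴹ-refl M))
        (λ ((x , x∈) , x≈y) → subquotient-zero⁺ P′ P y (resp-≈ᴹ P (x-y≈0⇒x≈y {M} x (proj₁ y) x≈y) x∈))
    }

  module _ (P : Submodule M) (f : Hom L (quot P)) where

    -- The preimage in M of the image of `f`, so that `enlarge / P` is this image, a quotient of L.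
    -- If `f` is nonzero, the map from M / P to M / `enlarge` kills a nonzero element, which makes
    -- repeated enlarging terminate.
    enlarge : Submodule M
    enlarge = preimageSubmodule (toQuot P) (image f)

    enlarge-⊇ : P ⊆ enlarge
    enlarge-⊇ {x} x∈ = 0ᴹ L , ≈ᴹ-trans (quot P) {⟦ f ⟧ (0ᴹ L)} {0ᴹ (quot P)} {x , tt} (0ᴹ-homo f)
      (≈ᴹ-sym (quot P) {x , tt} {0ᴹ (quot P)} (subquotient-zero⁺ (wholeSubmodule M) P (x , tt) x∈))

    enlarge-factor : QuotientOf L (enlarge / P)
    enlarge-factor = h , surjective h λ (y , l , fl≈y) → l , fl≈y
      where
      h : Hom L (enlarge / P)
      h = proj₁ (factor-through-injection (inclQuot enlarge P) (λ x≈y → x≈y) f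
            λ l → (proj₁ (⟦ f ⟧ l) , l , ≈ᴹ-refl (quot P) {⟦ f ⟧ l}) , ≈ᴹ-refl (quot P) {⟦ f ⟧ l})

    enlarge-quot : Hom (quot P) (quot enlarge)
    enlarge-quot = quot-mono P enlarge enlarge-⊇

    enlarge-quot-surjective : IsSurjective enlarge-quot
    enlarge-quot-surjective = surjective enlarge-quot λ x → x , ≈ᴹ-refl (quot enlarge) {x}

    enlarge-quot-image : ∀ l → quot enlarge ∋ ⟦ enlarge-quot ⟧ (⟦ f ⟧ l) ≈ 0ᴹ (quot enlarge)
    enlarge-quot-image l = subquotient-zero⁺ (wholeSubmodule M) enlarge (⟦ f ⟧ l) (l , ≈ᴹ-refl (quot P) {⟦ f ⟧ l})

  module _ (P : Submodule M) (f : Hom (sub P) L) where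

    -- The kernel of `f` viewed inside M. By the first isomorphism theorem the factor cut off from P
    -- embeds in L.
    shrink : Submodule M
    shrink = push P (kernel f)

    shrink-⊆ : shrink ⊆ P
    shrink-⊆ (x∈ , _) = x∈

    shrink-factor : SubmoduleOf L (P / shrink)
    shrink-factor = h , kernel-injective h λ x hx≈0 →
        subquotient-zero⁺ P shrink x (proj₂ x , ≈ᴹ-trans L (≈ᴹ-sym L (hp≈f x)) hx≈0)
      where
      factored : Σ[ h ∈ Hom (P / shrink) L ] ∀ x → L ∋ ⟦ h ⟧ (⟦ proj P shrink ⟧ x) ≈ ⟦ f ⟧ x
      factored = factor-through-surjection (proj P shrink) (proj-surjective P shrink) f λ x x≈0 →
        let x∈ , fx≈0 = subquotient-zero⁻ P shrink x x≈0
        -- The two elements of `sub P` differ only in their membership proofs.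
        in ≈ᴹ-trans L (⟦⟧-cong f {x} {proj₁ x , x∈} (x≈y⇒x-y≈0 {M} (≈ᴹ-refl M))) fx≈0
      h : Hom (P / shrink) L
      h = proj₁ factored
      hp≈f : ∀ x → L ∋ ⟦ h ⟧ (⟦ proj P shrink ⟧ x) ≈ ⟦ f ⟧ x
      hp≈f = proj₂ factored

-- Descent of spanning lengths for modules over a k-algebra.

module FiniteDimension {ℓ} (em : ExcludedMiddle ℓ) {k : Field ℓ} (A : Algebra k) where

  private module k = Field k
  open Algebra A using (ring; ι; ι-homo)
  open RingMorphisms k.rawRing (Algebra.rawRing A) using (module IsRingHomomorphism)
  open IsRingHomomorphism ι-homo using ()
    renaming (⟦⟧-cong to ι-cong; +-homo to ι-+; *-homo to ι-*; 0#-homo to ι-0; 1#-homo to ι-1)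
  open Modules ring
  open Homomorphisms ring
  open Hom
  open Submodule

  private
    variable
      M N : LeftModule ring ℓ ℓ
      n   : ℕ

  restrictScalars : LeftModule ring ℓ ℓ → LeftModule k.ring ℓ ℓ
  restrictScalars M = record
    { Carrierᴹ     = Carrierᴹ
    ; _≈ᴹ_         = _≈ᴹ_
    ; _+ᴹ_         = _+ᴹ_
    ; _*ₗ_         = λ c x → ι c *ₗ x
    ; 0ᴹ           = 0ᴹ
    ; -ᴹ_          = -ᴹ_
    ; isLeftModule = record
      { isLeftSemimodule = record
        { +ᴹ-isCommutativeMonoid = +ᴹ-isCommutativeMonoid
        ; isPreleftSemimodule = record
          { *ₗ-cong      = λ c≈d x≈y → *ₗ-cong (ι-cong c≈d) x≈y
          ; *ₗ-zeroˡ     = λ x → ≈ᴹ-trans (*ₗ-congʳ ι-0) (*ₗ-zeroˡ x)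
          ; *ₗ-distribʳ  = λ x c d → ≈ᴹ-trans (*ₗ-congʳ (ι-+ c d)) (*ₗ-distribʳ x _ _)
          ; *ₗ-identityˡ = λ x → ≈ᴹ-trans (*ₗ-congʳ ι-1) (*ₗ-identityˡ x)
          ; *ₗ-assoc     = λ c d x → ≈ᴹ-trans (*ₗ-congʳ (ι-* c d)) (*ₗ-assoc _ _ x)
          ; *ₗ-zeroʳ     = λ c → *ₗ-zeroʳ (ι c)
          ; *ₗ-distribˡ  = λ c → *ₗ-distribˡ (ι c)
          }
        }
      ; -ᴹ‿cong    = -ᴹ‿cong
      ; -ᴹ‿inverse = -ᴹ‿inverse
      }
    }
    where open LeftModule M

  restrictSubmodule : Submodule M → Modules.Submodule k.ring (restrictScalars M)
  restrictSubmodule N = record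
    { member    = member N
    ; resp-≈ᴹ   = resp-≈ᴹ N
    ; 0ᴹ-closed = 0ᴹ-closed N
    ; +ᴹ-closed = +ᴹ-closed N
    ; *ₗ-closed = λ c → *ₗ-closed N (ι c)
    }

  module K (M : LeftModule ring ℓ ℓ) = LinearAlgebra em k (restrictScalars M)

  Spanned : ℕ → LeftModule ring ℓ ℓ → Set ℓ
  Spanned n M = Σ[ v ∈ (Fin n → Carrierᴹ) ] ∀ x → ∃[ c ] x ≈ᴹ K.lincomb M c v
    where open LeftModule M

  SpannedBelow : ℕ → LeftModule ring ℓ ℓ → Set ℓ
  SpannedBelow n M = ∃[ m ] n ≡ sucℕ m × Spanned m M

  homo-lincomb : (f : Hom M N) → ∀ {n} c (v : Fin n → LeftModule.Carrierᴹ M) →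
                 LeftModule._≈ᴹ_ N (⟦ f ⟧ (K.lincomb M c v)) (K.lincomb N c (λ i → ⟦ f ⟧ (v i)))
  homo-lincomb         f {0}      c v = 0ᴹ-homo f
  homo-lincomb {M} {N} f {sucℕ n} c v =
    ≈ᴹ-trans (+ᴹ-homo f _ _) (+ᴹ-cong (*ₗ-homo f _ _) (homo-lincomb {M} {N} f (tail c) (tail v)))
    where open LeftModule N

  spanned-quotient : QuotientOf M N → Spanned n M → Spanned n N
  spanned-quotient {M} {N} (f , f-surj) (v , spans) = (λ i → ⟦ f ⟧ (v i)) , λ y →
    let x , fx≈y = preimage f f-surj y
        c , x≈   = spans x
    in c , ≈ᴹ-trans (≈ᴹ-sym fx≈y) (≈ᴹ-trans (⟦⟧-cong f x≈) (homo-lincomb {M} {N} f c v))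
    where open LeftModule N

  private
    generated⇒spanned : (U : Submodule M) → K.Generated M n (restrictSubmodule U) → Spanned n (sub U)
    generated⇒spanned {M} U (w , w∈ , spans) = (λ i → w i , w∈ i) , λ (x , x∈) →
      let c , x≈ = spans x∈
      in c , incl-injective U {x , x∈} {K.lincomb (sub U) c (λ i → w i , w∈ i)}
               (LeftModule.≈ᴹ-trans M x≈ (LeftModule.≈ᴹ-sym M (homo-lincomb {sub U} {M} (incl U) c (λ i → w i , w∈ i))))

  -- The family spanning M need not lie in U; generators inside U come from elimination over k.
  spanned-sub : Spanned n M → (U : Submodule M) → Spanned n (sub U)
  spanned-sub {n} {M} (v , spans) U = generated⇒spanned U generated
    where
    generated : K.Generated M n (restrictSubmodule U)
    generated with K.subspace-generated M v (restrictSubmodule U) (λ {x} _ → spans x)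
    ... | inj₁ v∈ = v , v∈ , λ {x} _ → spans x
    ... | inj₂ g  = K.generated-below M {U = restrictSubmodule U} g

  spanned-proper-sub : Spanned n M → (U : Submodule M) {x : LeftModule.Carrierᴹ M} → ¬ member U x → SpannedBelow n (sub U)
  spanned-proper-sub {n} {M} (v , spans) U {x} x∉ with K.subspace-generated M v (restrictSubmodule U) (λ {x} _ → spans x)
  ... | inj₁ v∈ = ⊥-elim (x∉ (let c , x≈ = spans x in
                    resp-≈ᴹ U (LeftModule.≈ᴹ-sym M x≈) (K.lincomb-closed M (restrictSubmodule U) c v v∈)))
  ... | inj₂ (m , n≡ , g) = m , n≡ , generated⇒spanned U g

  spanned-proper-quotient : Spanned n M → (f : Hom M N) → IsSurjective f → {x : LeftModule.Carrierᴹ M} →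
                            LeftModule._≈ᴹ_ N (⟦ f ⟧ x) (LeftModule.0ᴹ N) →
                            ¬ LeftModule._≈ᴹ_ M x (LeftModule.0ᴹ M) → SpannedBelow n N
  spanned-proper-quotient {n} {M} {N} (v , spans) f f-surj {x} fx≈0 x≉0
    with K.span-modulo M v (restrictSubmodule (kernel f)) (spans x) fx≈0 x≉0
  ... | m , n≡ , u , spanned = m , n≡ , (λ i → ⟦ f ⟧ (u i)) , λ y →
          let x , fx≈y                  = preimage f f-surj y
              z , t , (c , z≈) , ft≈0 , x≈ = spanned (spans x)
          in c , (begin
            y                       ≈⟨ fx≈y ⟨
            ⟦ f ⟧ x                 ≈⟨ ⟦⟧-cong f x≈ ⟩
            ⟦ f ⟧ (z M.+ᴹ t)        ≈⟨ +ᴹ-homo f z t ⟩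
            ⟦ f ⟧ z +ᴹ ⟦ f ⟧ t      ≈⟨ +ᴹ-congˡ ft≈0 ⟩
            ⟦ f ⟧ z +ᴹ 0ᴹ           ≈⟨ +ᴹ-identityʳ _ ⟩
            ⟦ f ⟧ z                 ≈⟨ ⟦⟧-cong f z≈ ⟩
            ⟦ f ⟧ (K.lincomb M c u) ≈⟨ homo-lincomb {M} {N} f c u ⟩
            _                       ∎)
    where
    module M = LeftModule M
    open LeftModule N
    open SetoidReasoning ≈ᴹ-setoid

module TorsionClassesAndBricks {ℓ} (em : ExcludedMiddle (suc ℓ)) {k : Field ℓ} (A : FiniteDimensionalAlgebra k) where

  open FiniteDimensionalAlgebra A using (algebra; ring)
  open RepresentationTheory A
  open FDModule using (mod; finiteDimensional)
  open Homomorphisms ring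
  open FiniteDimension (lowerEM em) algebra
  open Hom
  open Submodule

  private
    Mod : Set (suc ℓ)
    Mod = LeftModule ring ℓ ℓ

    em₀ : ExcludedMiddle ℓ
    em₀ = lowerEM em

    variable
      L M N : Mod
      n : ℕ

    infix 4 _∋_≈0
    _∋_≈0 : (M : Mod) → LeftModule.Carrierᴹ M → Set ℓ
    M ∋ x ≈0 = LeftModule._≈ᴹ_ M x (LeftModule.0ᴹ M)

  subᶠ quotᶠ : (M : FDModule) → Submodule (mod M) → FDModule
  subᶠ  (fdModule M (n , spanned)) U = fdModule (sub U) (n , spanned-sub spanned U)
  quotᶠ (fdModule M (n , spanned)) U = fdModule (quot U) (n , spanned-quotient (quot-quotient U) spanned)

  subquotᶠ : (M : FDModule) → Submodule (mod M) → Submodule (mod M) → FDModule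
  subquotᶠ (fdModule M (n , spanned)) N P =
    fdModule (N / P) (n , spanned-quotient (proj N P , proj-surjective N P) (spanned-sub spanned N))

  ¬HomIsNonzero⇒HomIsZero : ¬ HomIsNonzero M N → HomIsZero M N
  ¬HomIsNonzero⇒HomIsZero ¬nz f x = decidable-stable em₀ λ fx≉0 → ¬nz (f , λ f≡0 → fx≉0 (f≡0 x))

  ¬HomIsZero⇒HomIsNonzero : ¬ HomIsZero M N → HomIsNonzero M N
  ¬HomIsZero⇒HomIsNonzero ¬z = decidable-stable em₀ λ ¬nz → ¬z (¬HomIsNonzero⇒HomIsZero ¬nz)

  nonzero-value : (f : Hom M N) → ¬ IsZero f → ∃[ x ] ¬ (N ∋ ⟦ f ⟧ x ≈0)
  nonzero-value f f≢0 = decidable-stable em₀ λ ¬∃ → f≢0 λ x → decidable-stable em₀ λ fx≉0 → ¬∃ (x , fx≉0)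

  -- Endomorphisms of bricks, and descent to a brick.

  IsBrick HasProperEndo : Mod → Set ℓ
  IsBrick M = IsDivisionRing (endRing M)
  HasProperEndo M = Σ[ f ∈ Hom M M ] ¬ IsZero f × ∃[ y ] ¬ member (image f) y

  bijective-endos⇒isBrick : ¬ (∀ x → M ∋ x ≈0) →
                            (∀ (f : Hom M M) → ¬ IsZero f → IsInjective f × IsSurjective f) → IsBrick M
  bijective-endos⇒isBrick {M} M≢0 bijective = record
    { 1≉0        = M≢0
    ; invertible = λ f f≢0 →
        let f-inj , f-surj = bijective f f≢0
            -- Lifting the identity along `f` gives a right inverse; injectivity of `f` makes it
            -- two-sided.
            g , fg≈id      = factor-through-injection f f-inj idʰ (preimage f f-surj)
        in g , (λ x → f-inj (fg≈id (⟦ f ⟧ x))) , fg≈id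
    }

  brick-endo-bijective : IsBrick M → (f : Hom M M) → ¬ IsZero f → IsInjective f × IsSurjective f
  brick-endo-bijective {M} brick f f≢0 with IsDivisionRing.invertible brick f f≢0
  ... | g , gf≈id , fg≈id =
          (λ fx≈fy → ≈ᴹ-trans (≈ᴹ-sym (gf≈id _)) (≈ᴹ-trans (⟦⟧-cong g fx≈fy) (gf≈id _)))
        , surjective f (λ y → ⟦ g ⟧ y , fg≈id y)
    where open LeftModule M

  -- A surjective endomorphism that kills a nonzero element shows that M itself is
  -- spanned by fewer elements, so this can only happen finitely often.
  isBrick⊎hasProperEndo : ∀ n → Spanned n M → ¬ (∀ x → M ∋ x ≈0) → IsBrick M ⊎ HasProperEndo M
  isBrick⊎hasProperEndo {M} n spanned M≢0 with em₀ {HasProperEndo M}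
  ... | yes proper = inj₂ proper
  ... | no ¬proper with em₀ {Σ[ f ∈ Hom M M ] ¬ IsZero f × ∃[ x ] M ∋ ⟦ f ⟧ x ≈0 × ¬ (M ∋ x ≈0)}
  ...   | no ¬noninjective = inj₁ (bijective-endos⇒isBrick M≢0 λ f f≢0 →
            kernel-injective f (λ x fx≈0 → decidable-stable em₀ λ x≉0 → ¬noninjective (f , f≢0 , x , fx≈0 , x≉0))
          , surjective f (λ y → decidable-stable em₀ λ y∉ → ¬proper (f , f≢0 , y , y∉)))
  ...   | yes (f , f≢0 , x , fx≈0 , x≉0)
    with spanned-proper-quotient spanned f
           (surjective f λ y → decidable-stable em₀ λ y∉ → ¬proper (f , f≢0 , y , y∉)) fx≈0 x≉0
  ...     | m , refl , spanned′ = isBrick⊎hasProperEndo m spanned′ M≢0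

  -- Both replacements are strictly smaller: the image of `φ` misses `y`, and the quotient by it
  -- kills a nonzero value of `φ`.
  shrink-source : (L : FDModule) → Spanned n (mod L) → HomIsNonzero (mod L) N → HasProperEndo (mod L) →
                  ∃[ L′ ] QuotientOf (mod L) (mod L′) × SpannedBelow n (mod L′) × HomIsNonzero (mod L′) N
  shrink-source {N = N} L spanned (f , f≢0) (φ , φ≢0 , y , y∉) = case em₀ of λ
    { (no fφ≢0) → subᶠ L I , image-quotient φ , spanned-proper-sub spanned I y∉ , f ∘ʰ incl I , fφ≢0
    ; (yes fφ≡0) →
        let x , φx≉0  = nonzero-value φ φ≢0
            f′ , f′q≈f = factor-through-surjection (toQuot I) (toQuot-surjective I) f λ z qz≈0 →
                           fφ≡0 (z , subquotient-zero⁻ (wholeSubmodule (mod L)) I (z , tt) qz≈0)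
        in quotᶠ L I , quot-quotient I
         , spanned-proper-quotient spanned (toQuot I) (toQuot-surjective I)
             (subquotient-zero⁺ (wholeSubmodule (mod L)) I (⟦ φ ⟧ x , tt) (x , LeftModule.≈ᴹ-refl (mod L))) φx≉0
         , f′ , λ f′≡0 → f≢0 λ z → LeftModule.≈ᴹ-trans N (LeftModule.≈ᴹ-sym N (f′q≈f z)) (f′≡0 _)
    }
    where
    I : Submodule (mod L)
    I = image φ

  -- If `φ` after `f` is nonzero, it lands in the image of `φ`, which misses `y`. Otherwise `f`
  -- lands in the kernel of `φ`, which is proper because `φ` is nonzero.
  shrink-target : (M : FDModule) → Spanned n (mod M) → HomIsNonzero N (mod M) → HasProperEndo (mod M) →
                  ∃[ M′ ] SubmoduleOf (mod M) (mod M′) × SpannedBelow n (mod M′) × HomIsNonzero N (mod M′)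
  shrink-target M spanned (f , f≢0) (φ , φ≢0 , y , y∉) = case em₀ of λ
    { (no φf≢0) → subᶠ M I , sub-submodule I , spanned-proper-sub spanned I y∉ , toImage φ ∘ʰ f , λ φf≡0 →
        φf≢0 λ x → subquotient-zero⁻ I (zeroSubmodule (mod M)) (⟦ toImage φ ∘ʰ f ⟧ x) (φf≡0 x)
    ; (yes φf≡0) →
        let x , φx≉0  = nonzero-value φ φ≢0
            f′        = corestrict K f φf≡0
        in subᶠ M K , sub-submodule K , spanned-proper-sub spanned K φx≉0
         , f′ , λ f′≡0 → f≢0 λ z → subquotient-zero⁻ K (zeroSubmodule (mod M)) (⟦ f′ ⟧ z) (f′≡0 z)
    }
    where
    I K : Submodule (mod M)
    I = image φ
    K = kernel φ

  brick-in-source : {𝒯 : Class} → (∀ {M N} → QuotientOf (mod M) (mod N) → M ∈ 𝒯 → N ∈ 𝒯) →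
                    ∀ n L → Spanned n (mod L) → L ∈ 𝒯 → HomIsNonzero (mod L) N →
                    Σ[ B ∈ Brick ] Brick.fd B ∈ 𝒯 × HomIsNonzero (Brick.mod B) N
  brick-in-source {N} quotients n L spanned L∈ L⟶N@(f , f≢0)
    with isBrick⊎hasProperEndo n spanned (λ L≡0 → f≢0 λ x →
           LeftModule.≈ᴹ-trans N (⟦⟧-cong f (L≡0 x)) (0ᴹ-homo f))
  ... | inj₁ brick  = record { fd = L ; isBrick = brick } , L∈ , L⟶N
  ... | inj₂ proper with shrink-source L spanned L⟶N proper
  ...   | L′ , L↠L′ , (m , refl , spanned′) , L′⟶N = brick-in-source quotients m L′ spanned′ (quotients L↠L′ L∈) L′⟶N

  brick-in-target : {ℱ : Class} → (∀ {M N} → SubmoduleOf (mod M) (mod N) → M ∈ ℱ → N ∈ ℱ) →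
                    ∀ n M → Spanned n (mod M) → M ∈ ℱ → HomIsNonzero N (mod M) →
                    Σ[ B ∈ Brick ] Brick.fd B ∈ ℱ × HomIsNonzero N (Brick.mod B)
  brick-in-target {N} submodules n M spanned M∈ N⟶M@(f , f≢0)
    with isBrick⊎hasProperEndo n spanned (λ M≡0 → f≢0 λ x → M≡0 _)
  ... | inj₁ brick  = record { fd = M ; isBrick = brick } , M∈ , N⟶M
  ... | inj₂ proper with shrink-target M spanned N⟶M proper
  ...   | M′ , M′↪M , (m , refl , spanned′) , N⟶M′ = brick-in-target submodules m M′ spanned′ (submodules M′↪M M∈) N⟶M′

  -- Meant for the intersection of a torsion class with a torsion-free class. Such a class is in
  -- general closed neither under quotients nor under submodules, but the image of an endomorphism
  -- is both at once and stays inside.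
  brick-in-endo-closed : {𝒞 : Class} → (∀ {M} → M ∈ 𝒞 → (φ : Hom (mod M) (mod M)) → subᶠ M (image φ) ∈ 𝒞) →
                         ∀ n M → Spanned n (mod M) → M ∈ 𝒞 → ¬ (∀ x → mod M ∋ x ≈0) →
                         Σ[ B ∈ Brick ] Brick.fd B ∈ 𝒞
  brick-in-endo-closed images n M spanned M∈ M≢0 with isBrick⊎hasProperEndo n spanned M≢0
  ... | inj₁ brick = record { fd = M ; isBrick = brick } , M∈
  ... | inj₂ (φ , φ≢0 , y , y∉) with spanned-proper-sub spanned (image φ) y∉
  ...   | m , refl , spanned′ = brick-in-endo-closed images m (subᶠ M (image φ)) spanned′ (images M∈ φ)
            λ I≡0 → φ≢0 λ x → subquotient-zero⁻ (image φ) (zeroSubmodule (mod M)) (⟦ toImage φ ⟧ x) (I≡0 (⟦ toImage φ ⟧ x))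

  -- Filtrations and vanishing of Hom.

  filtration-map : ∀ {p q} {𝒫 : Pred FDModule p} {𝒬 : Pred FDModule q} → 𝒫 ⊆₁ 𝒬 → ∀ {M} → Filtration 𝒫 M → Filtration 𝒬 M
  filtration-map 𝒫⊆𝒬 F = record
    { length = length ; stage = stage ; bottom = bottom ; top = top ; mono = mono
    ; factor = λ i → let Q , Q∈ , iso = factor i in Q , 𝒫⊆𝒬 Q∈ , iso
    }
    where open Filtration F

  -- Induction up the filtration: once `f` vanishes on a stage, its restriction to the next one
  -- factors through the subquotient, which has no nonzero map to N.
  filtration-homIsZero-source : ∀ {q} {𝒬 : Pred FDModule q} {M} → Filtration 𝒬 M →
                                (∀ {Q} → Q ∈ 𝒬 → HomIsZero (mod Q) N) → HomIsZero (mod M) N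
  filtration-homIsZero-source {N = N} {M = M} F 𝒬⊥N f x =
    <-weakInduction (λ i → ∀ {x} → member (stage i) x → N ∋ ⟦ f ⟧ x ≈0)
      (λ x∈ → ≈ᴹ-trans (⟦⟧-cong f (bottom x∈)) (0ᴹ-homo f)) vanishes (fromℕ length) (top x)
    where
    open Filtration F
    open LeftModule N using (≈ᴹ-trans; ≈ᴹ-sym)
    vanishes : ∀ i → (∀ {x} → member (stage (inject₁ i)) x → N ∋ ⟦ f ⟧ x ≈0) →
                     ∀ {x} → member (stage (fsuc i)) x → N ∋ ⟦ f ⟧ x ≈0
    vanishes i f-vanishes {x} x∈ =
      let U             = stage (fsuc i)
          P             = stage (inject₁ i)
          Q , Q∈ , iso  = factor i
          h , hp≈f      = factor-through-surjection (proj U P) (proj-surjective U P) (f ∘ʰ incl U)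
                            (λ y y≈0 → f-vanishes (subquotient-zero⁻ U P y y≈0))
          e , e-surj    = ≅⇒quotient (mod Q) (U / P) (≅-sym (U / P) (mod Q) iso)
      in ≈ᴹ-trans (≈ᴹ-sym (hp≈f (x , x∈)))
           (zero-after-surjection e e-surj h (𝒬⊥N Q∈ (h ∘ʰ e)) (x , x∈))

  -- Induction down from the top: a map landing in a stage becomes zero in the subquotient by the
  -- stage below, hence already lands in that lower stage.
  filtration-homIsZero-target : ∀ {q} {𝒬 : Pred FDModule q} {M} → Filtration 𝒬 M →
                                (∀ {Q} → Q ∈ 𝒬 → HomIsZero N (mod Q)) → HomIsZero N (mod M)
  filtration-homIsZero-target {N = N} {M = M} F N⊥𝒬 g x = bottom
    (>-weakInduction (λ i → ∀ x → member (stage i) (⟦ g ⟧ x)) (λ x → top _) lowers fzero x)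
    where
    open Filtration F
    lowers : ∀ i → (∀ x → member (stage (fsuc i)) (⟦ g ⟧ x)) → ∀ x → member (stage (inject₁ i)) (⟦ g ⟧ x)
    lowers i g∈ x =
      let U             = stage (fsuc i)
          P             = stage (inject₁ i)
          Q , Q∈ , iso  = factor i
          e , e-inj     = ≅⇒submodule (U / P) (mod Q) iso
          g′            = corestrict U g g∈
      in subquotient-zero⁻ U P (⟦ g′ ⟧ x)
           (zero-before-injection e e-inj (proj U P ∘ʰ g′) (N⊥𝒬 Q∈ (e ∘ʰ proj U P ∘ʰ g′)) x)

  -- A filtration of M / P, as a chain of submodules of M from P to M.
  data Chain {q} (𝒬 : Pred FDModule q) (M : FDModule) (P : Submodule (mod M)) : Set (suc ℓ ⊔ q) where
    done : (∀ x → member P x) → Chain 𝒬 M P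
    step : (P′ : Submodule (mod M)) → P ⊆ P′ → subquotᶠ M P′ P ∈ 𝒬 → Chain 𝒬 M P′ → Chain 𝒬 M P

  module _ {q} {𝒬 : Pred FDModule q} {M : FDModule} where

    chain-length : {P : Submodule (mod M)} → Chain 𝒬 M P → ℕ
    chain-length (done _)       = 0
    chain-length (step _ _ _ c) = sucℕ (chain-length c)

    chain-stage : {P : Submodule (mod M)} (c : Chain 𝒬 M P) → Fin (sucℕ (chain-length c)) → Submodule (mod M)
    chain-stage {P} c              fzero    = P
    chain-stage     (step _ _ _ c) (fsuc i) = chain-stage c i

    chain⇒filtration : {P : Submodule (mod M)} → (∀ {x} → member P x → mod M ∋ x ≈0) → Chain 𝒬 M P → Filtration 𝒬 M
    chain⇒filtration P≡0 c = record
      { length = chain-length c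
      ; stage  = chain-stage c
      ; bottom = P≡0
      ; top    = top c
      ; mono   = mono c
      ; factor = factor c
      }
      where
      top : {P : Submodule (mod M)} (c : Chain 𝒬 M P) → ∀ x → member (chain-stage c (fromℕ (chain-length c))) x
      top (done P≡M)     = P≡M
      top (step _ _ _ c) = top c
      mono : {P : Submodule (mod M)} (c : Chain 𝒬 M P) → ∀ i → chain-stage c (inject₁ i) ⊆ chain-stage c (fsuc i)
      mono (step _ P⊆P′ _ c) fzero    = P⊆P′
      mono (step _ _    _ c) (fsuc i) = mono c i
      factor : {P : Submodule (mod M)} (c : Chain 𝒬 M P) → ∀ i →
               ∃[ Q ] Q ∈ 𝒬 × (chain-stage c (fsuc i) / chain-stage c (inject₁ i)) ≅ mod Q
      factor {P} (step P′ _ Q∈ c) fzero    = subquotᶠ M P′ P , Q∈ , IsEquivalence.refl ≅-isEquivalence {P′ / P}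
      factor     (step _  _ _  c) (fsuc i) = factor c i

  QuotientsOf SubmodulesOf : Class → Class
  QuotientsOf  𝒞 Q = ∃[ L ] L ∈ 𝒞 × QuotientOf  (mod L) (mod Q)
  SubmodulesOf 𝒞 Q = ∃[ L ] L ∈ 𝒞 × SubmoduleOf (mod L) (mod Q)

  -- Unless P is all of M, the nonzero map M → M / P shows that some L ∈ 𝒞 has a
  -- nonzero map to M / P; its image is the next factor.
  grow : {𝒞 : Class} {M : FDModule} → M ∈ ⊥ᴹ^ (𝒞 ^⊥ᴹ) → (P : Submodule (mod M)) →
         (∀ x → member P x) ⊎
         ∃[ P′ ] P ⊆ P′ × subquotᶠ M P′ P ∈ QuotientsOf 𝒞 × (∀ n → Spanned n (quot P) → SpannedBelow n (quot P′))
  grow {𝒞} {M} M∈ P = case em {∃[ L ] L ∈ 𝒞 × HomIsNonzero (mod L) (quot P)} of λ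
    { (no ¬∃) → inj₁ λ x → subquotient-zero⁻ (wholeSubmodule (mod M)) P (x , tt)
        (M∈ {quotᶠ M P} (λ {L} L∈ → ¬HomIsNonzero⇒HomIsZero λ nz → ¬∃ (L , L∈ , nz)) (toQuot P) x)
    ; (yes (L , L∈ , f , f≢0)) →
        let l , fl≉0 = nonzero-value f f≢0
        in inj₂ (enlarge P f , (λ {x} → enlarge-⊇ P f {x}) , (L , L∈ , enlarge-factor P f) , λ n spanned →
             spanned-proper-quotient spanned (enlarge-quot P f) (enlarge-quot-surjective P f)
               {⟦ f ⟧ l} (enlarge-quot-image P f l) fl≉0)
    }

  -- If P has no nonzero map to any member of 𝒞, then P is left orthogonal to 𝒞, so its inclusion
  -- into M vanishes. Otherwise the kernel of such a map is the next stage down.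
  trim : {𝒞 : Class} {M : FDModule} → M ∈ (⊥ᴹ^ 𝒞) ^⊥ᴹ → (P : Submodule (mod M)) →
         (∀ {x} → member P x → mod M ∋ x ≈0) ⊎
         ∃[ P′ ] P′ ⊆ P × subquotᶠ M P P′ ∈ SubmodulesOf 𝒞 × (∀ n → Spanned n (sub P) → SpannedBelow n (sub P′))
  trim {𝒞} {M} M∈ P = case em {∃[ L ] L ∈ 𝒞 × HomIsNonzero (sub P) (mod L)} of λ
    { (no ¬∃) → inj₁ λ {x} x∈ →
        M∈ {subᶠ M P} (λ {L} L∈ → ¬HomIsNonzero⇒HomIsZero λ nz → ¬∃ (L , L∈ , nz)) (incl P) (x , x∈)
    ; (yes (L , L∈ , f , f≢0)) →
        let x , fx≉0 = nonzero-value f f≢0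
        in inj₂ (shrink P f , (λ {x} → shrink-⊆ P f {x}) , (L , L∈ , shrink-factor P f) , λ n spanned →
             let m , n≡ , spanned′ = spanned-proper-sub spanned (kernel f) {x} fx≉0
             in m , n≡ , spanned-quotient (push-quotient P (kernel f)) spanned′)
    }

  quotient-chain : {𝒞 : Class} {M : FDModule} → M ∈ ⊥ᴹ^ (𝒞 ^⊥ᴹ) → Chain (QuotientsOf 𝒞) M (zeroSubmodule (mod M))
  quotient-chain {𝒞} {M} M∈ = build (proj₁ (finiteDimensional (quotᶠ M 𝟘))) 𝟘 (proj₂ (finiteDimensional (quotᶠ M 𝟘)))
    where
    𝟘 : Submodule (mod M)
    𝟘 = zeroSubmodule (mod M)
    build : ∀ n P → Spanned n (quot P) → Chain (QuotientsOf 𝒞) M P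
    build n P spanned with grow {𝒞} {M} (λ {N} → M∈ {N}) P
    ... | inj₁ P≡M = done P≡M
    ... | inj₂ (P′ , P⊆P′ , factor , drop) with drop n spanned
    ...   | m , refl , spanned′ = step P′ P⊆P′ factor (build m P′ spanned′)

  -- Trimming runs from the top downwards while a `Chain` is read from the bottom upwards, so the
  -- chain already obtained is carried along as an accumulator and each new P is put in front of it.
  submodule-chain : {𝒞 : Class} {M : FDModule} → M ∈ (⊥ᴹ^ 𝒞) ^⊥ᴹ →
                    Σ[ P ∈ Submodule (mod M) ] (∀ {x} → member P x → mod M ∋ x ≈0) × Chain (SubmodulesOf 𝒞) M P
  submodule-chain {𝒞} {M} M∈ =
    build (proj₁ (finiteDimensional (subᶠ M 𝟙))) 𝟙 (proj₂ (finiteDimensional (subᶠ M 𝟙))) (done λ _ → tt)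
    where
    𝟙 : Submodule (mod M)
    𝟙 = wholeSubmodule (mod M)
    build : ∀ n P → Spanned n (sub P) → Chain (SubmodulesOf 𝒞) M P →
            Σ[ P ∈ Submodule (mod M) ] (∀ {x} → member P x → mod M ∋ x ≈0) × Chain (SubmodulesOf 𝒞) M P
    build n P spanned c with trim {𝒞} {M} (λ {N} → M∈ {N}) P
    ... | inj₁ P≡0 = P , P≡0 , c
    ... | inj₂ (P′ , P′⊆P , factor , drop) with drop n spanned
    ...   | m , refl , spanned′ = build m P′ spanned′ (step P P′⊆P factor c)

  ∈⊥⟨^⊥⟩⇒filtration : {𝒞 : Class} {M : FDModule} → M ∈ ⊥ᴹ^ (𝒞 ^⊥ᴹ) → Filtration (QuotientsOf 𝒞) M
  ∈⊥⟨^⊥⟩⇒filtration M∈ = chain⇒filtration (λ x≈0 → x≈0) (quotient-chain λ {N} → M∈ {N})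

  ∈⟨⊥^⟩⊥⇒filtration : {𝒞 : Class} {M : FDModule} → M ∈ (⊥ᴹ^ 𝒞) ^⊥ᴹ → Filtration (SubmodulesOf 𝒞) M
  ∈⟨⊥^⟩⊥⇒filtration M∈ = let P , P≡0 , c = submodule-chain (λ {N} → M∈ {N}) in chain⇒filtration P≡0 c

  -- Orthogonal classes as torsion and torsion-free classes.

  homIsZero-zeroModule-source : HomIsZero (mod zeroModule) N
  homIsZero-zeroModule-source f _ = 0ᴹ-homo f

  ⊥ᴹ^-isTorsionClass : (𝒟 : Class) → IsTorsionClass (⊥ᴹ^ 𝒟)
  ⊥ᴹ^-isTorsionClass 𝒟 = record
    { isExtensionClosed = record
      { resp-≅     = λ {M} {N} M≅N L⊥ D∈ → homIsZero-resp-source (mod M) (mod N) M≅N (L⊥ D∈)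
      ; zero       = λ {D} _ → homIsZero-zeroModule-source {mod D}
      ; extensions = λ E L⊥ N⊥ D∈ → homIsZero-extension-source E (L⊥ D∈) (N⊥ D∈)
      }
    ; quotients = λ Q L⊥ D∈ → homIsZero-quotient Q (L⊥ D∈)
    }

  ^⊥ᴹ-isTorsionFreeClass : (𝒟 : Class) → IsTorsionFreeClass (𝒟 ^⊥ᴹ)
  ^⊥ᴹ-isTorsionFreeClass 𝒟 = record
    { isExtensionClosed = record
      { resp-≅     = λ {M} {N} M≅N ⊥M D∈ → homIsZero-resp-target (mod M) (mod N) M≅N (⊥M D∈)
      ; zero       = λ _ _ _ → tt
      ; extensions = λ E ⊥L ⊥N D∈ → homIsZero-extension-target E (⊥L D∈) (⊥N D∈)
      }
    ; submodules = λ Q ⊥M D∈ → homIsZero-submodule Q (⊥M D∈)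
    }

  isExtensionClosed-resp-≐ : {𝒞 𝒟 : Class} → 𝒞 ≐ 𝒟 → IsExtensionClosedSubcategory 𝒞 → IsExtensionClosedSubcategory 𝒟
  isExtensionClosed-resp-≐ (𝒞⊆𝒟 , 𝒟⊆𝒞) closed = record
    { resp-≅     = λ M≅N M∈ → 𝒞⊆𝒟 (resp-≅ M≅N (𝒟⊆𝒞 M∈))
    ; zero       = 𝒞⊆𝒟 zero
    ; extensions = λ E L∈ N∈ → 𝒞⊆𝒟 (extensions E (𝒟⊆𝒞 L∈) (𝒟⊆𝒞 N∈))
    }
    where open IsExtensionClosedSubcategory closed

  isTorsionClass-resp-≐ : {𝒯 𝒯′ : Class} → 𝒯 ≐ 𝒯′ → IsTorsionClass 𝒯 → IsTorsionClass 𝒯′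
  isTorsionClass-resp-≐ 𝒯≐𝒯′ torsion = record
    { isExtensionClosed = isExtensionClosed-resp-≐ 𝒯≐𝒯′ isExtensionClosed
    ; quotients         = λ Q M∈ → proj₁ 𝒯≐𝒯′ (quotients Q (proj₂ 𝒯≐𝒯′ M∈))
    }
    where open IsTorsionClass torsion

  isTorsionFreeClass-resp-≐ : {ℱ ℱ′ : Class} → ℱ ≐ ℱ′ → IsTorsionFreeClass ℱ → IsTorsionFreeClass ℱ′
  isTorsionFreeClass-resp-≐ ℱ≐ℱ′ torsionFree = record
    { isExtensionClosed = isExtensionClosed-resp-≐ ℱ≐ℱ′ isExtensionClosed
    ; submodules        = λ Q M∈ → proj₁ ℱ≐ℱ′ (submodules Q (proj₂ ℱ≐ℱ′ M∈))
    }
    where open IsTorsionFreeClass torsionFree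

  -- M has a chain whose factors are quotients of members of 𝒯, hence in 𝒯. Climbing it, closure
  -- under extensions carries membership in 𝒯 from each stage to the next.
  ⊥⟨𝒯^⊥⟩⊆𝒯 : {𝒯 : Class} → IsTorsionClass 𝒯 → ⊥ᴹ^ (𝒯 ^⊥ᴹ) ⊆₁ 𝒯
  ⊥⟨𝒯^⊥⟩⊆𝒯 {𝒯} torsion {M} M∈ = climb (quotient-chain λ {N} → M∈ {N})
    (quotients {zeroModule} {subᶠ M (zeroSubmodule (mod M))} (z , z-surj) zero)
    where
    open IsTorsionClass torsion
    -- The climb starts in 𝒯 because the zero submodule is a quotient of `zeroModule`.
    z : Hom (mod zeroModule) (sub (zeroSubmodule (mod M)))
    z = record { ⟦_⟧ = λ _ → LeftModule.0ᴹ S ; isHomo = mkIsHomo {mod zeroModule} {S}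
          (λ _ → LeftModule.≈ᴹ-refl S {LeftModule.0ᴹ S})
          (λ _ _ → LeftModule.≈ᴹ-sym S {0+0} {LeftModule.0ᴹ S} (LeftModule.+ᴹ-identityˡ S (LeftModule.0ᴹ S)))
          (λ r _ → LeftModule.≈ᴹ-sym S {LeftModule._*ₗ_ S r (LeftModule.0ᴹ S)} {LeftModule.0ᴹ S} (LeftModule.*ₗ-zeroʳ S r)) }
      where
      S = sub (zeroSubmodule (mod M))
      0+0 = LeftModule._+ᴹ_ S (LeftModule.0ᴹ S) (LeftModule.0ᴹ S)
    z-surj : IsSurjective z
    z-surj = surjective z λ (x , x≈0) → _ , x≈y⇒x-y≈0 {mod M} (LeftModule.≈ᴹ-sym (mod M) x≈0)
    climb : ∀ {P} → Chain (QuotientsOf 𝒯) M P → subᶠ M P ∈ 𝒯 → M ∈ 𝒯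
    climb {P} (done P≡M) P∈ = quotients {subᶠ M P} {M}
      (incl P , surjective (incl P) λ x → (x , P≡M x) , LeftModule.≈ᴹ-refl (mod M)) P∈
    climb {P} (step P′ P⊆P′ (L , L∈ , quotient) c) P∈ = climb c
      (extensions {subᶠ M P} {subᶠ M P′} {subquotᶠ M P′ P} (sub-shortExact P P′ P⊆P′) P∈ (quotients quotient L∈))

  -- Bricks and the relations between them.

  ⟨_⟩ : Brick → Class
  ⟨ L ⟩ M = M ≡ Brick.fd L

  ⌊_⌋ : Pred Brick (suc ℓ) → Class
  ⌊ X ⌋ M = ∃[ B ] B ∈ X × Brick.fd B ≡ M

  nonzero⇒¬zero : HomIsNonzero M N → ¬ HomIsZero M N
  nonzero⇒¬zero (f , f≢0) M⊥N = f≢0 (M⊥N f)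

  brick-endos-nonzero : (B : Brick) → ¬ HomIsZero (Brick.mod B) (Brick.mod B)
  brick-endos-nonzero B B⊥B = IsDivisionRing.1≉0 (Brick.isBrick B) (B⊥B idʰ)

  torsion-detected-by-bricks : {𝒯 : Class} → IsTorsionClass 𝒯 → ∀ {M N} → M ∈ 𝒯 →
                               (∀ B → Brick.fd B ∈ 𝒯 → ¬ HomIsNonzero (Brick.mod B) N) → HomIsZero (mod M) N
  torsion-detected-by-bricks {𝒯} torsion {M} M∈ bricks = ¬HomIsNonzero⇒HomIsZero λ nz →
    let n , spanned    = finiteDimensional M
        B , B∈ , B⟶N = brick-in-source {𝒯 = 𝒯} (λ {M} {N} → IsTorsionClass.quotients torsion {M} {N})
                         n M spanned M∈ nz
    in bricks B B∈ B⟶N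

  torsionFree-detected-by-bricks : {ℱ : Class} → IsTorsionFreeClass ℱ → ∀ {M N} → N ∈ ℱ →
                                   (∀ B → Brick.fd B ∈ ℱ → ¬ HomIsNonzero M (Brick.mod B)) → HomIsZero M (mod N)
  torsionFree-detected-by-bricks {ℱ} torsionFree {N = N} N∈ bricks = ¬HomIsNonzero⇒HomIsZero λ nz →
    let n , spanned    = finiteDimensional N
        B , B∈ , M⟶B = brick-in-target {ℱ = ℱ} (λ {M} {N} → IsTorsionFreeClass.submodules torsionFree {M} {N})
                         n N spanned N∈ nz
    in bricks B B∈ M⟶B

  module _ {L M : Brick} where
    private
      module L = Brick L
      module M = Brick M

    ↠⇒homIsZero : L ↠ M → HomIsZero L.mod N → HomIsZero M.mod N
    ↠⇒homIsZero F L⊥N = filtration-homIsZero-source F λ Q∈ → homIsZero-quotient Q∈ L⊥N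

    -- The hypothesis places M in the double orthogonal of the single module L, where the greedy
    -- filtration applies.
    homIsZero⇒↠ : (∀ N → HomIsZero L.mod (mod N) → HomIsZero M.mod (mod N)) → L ↠ M
    homIsZero⇒↠ h = filtration-map (λ { (_ , refl , Q) → Q }) (∈⊥⟨^⊥⟩⇒filtration {⟨ L ⟩} λ {N} L⊥N → h N (L⊥N refl))

    ↪⇒homIsZero : L ↪ M → HomIsZero N M.mod → HomIsZero N L.mod
    ↪⇒homIsZero F N⊥M = filtration-homIsZero-target F λ Q∈ → homIsZero-submodule Q∈ N⊥M

    homIsZero⇒↪ : (∀ N → HomIsZero (mod N) M.mod → HomIsZero (mod N) L.mod) → L ↪ M
    homIsZero⇒↪ h = filtration-map (λ { (_ , refl , Q) → Q }) (∈⟨⊥^⟩⊥⇒filtration {⟨ M ⟩} λ {N} N⊥M → h N (N⊥M refl))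

    ↠⇒⟶ : L ↠ M → L ⟶ M
    ↠⇒⟶ L↠M = ¬HomIsZero⇒HomIsNonzero λ L⊥M → brick-endos-nonzero M (↠⇒homIsZero L↠M L⊥M)

    ↪⇒⟶ : L ↪ M → L ⟶ M
    ↪⇒⟶ L↪M = ¬HomIsZero⇒HomIsNonzero λ L⊥M → brick-endos-nonzero L (↪⇒homIsZero L↪M L⊥M)

    -- The image I of `f` is a nonzero quotient of M, so `L ↠ M` provides a nonzero map from L to I.
    -- Followed by the inclusion of I it is a nonzero endomorphism of the brick L, hence surjective,
    -- and I is all of L.
    ↠⇒surjective : L ↠ M → (f : Hom M.mod L.mod) → ¬ IsZero f → IsSurjective f
    ↠⇒surjective L↠M f f≢0 = surjective f λ y →
      let x , gx≈y = preimage (incl I ∘ʰ g) ig-surj y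
          z , fz≈  = proj₂ (⟦ g ⟧ x)
      in z , LeftModule.≈ᴹ-trans L.mod fz≈ gx≈y
      where
      I = image f
      L⟶I : HomIsNonzero L.mod (sub I)
      L⟶I = ¬HomIsZero⇒HomIsNonzero λ L⊥I → f≢0 λ x →
        subquotient-zero⁻ I (zeroSubmodule L.mod) (⟦ toImage f ⟧ x) (↠⇒homIsZero L↠M L⊥I (toImage f) x)
      g = proj₁ L⟶I
      ig-surj : IsSurjective (incl I ∘ʰ g)
      ig-surj = proj₂ (brick-endo-bijective L.isBrick (incl I ∘ʰ g) λ ig≡0 → proj₂ L⟶I λ x →
        subquotient-zero⁺ I (zeroSubmodule L.mod) (⟦ g ⟧ x) (ig≡0 x))

    -- The image I of `f` has a nonzero map to L, so `L ↪ M` provides a nonzero map from I to M.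
    -- Preceded by the surjection of M onto I it is an injective endomorphism of the brick M, and it
    -- factors through `f`.
    ↪⇒injective : L ↪ M → (f : Hom M.mod L.mod) → ¬ IsZero f → IsInjective f
    ↪⇒injective L↪M f f≢0 fx≈fy = proj₁ (brick-endo-bijective M.isBrick (g ∘ʰ toImage f) λ gf≡0 →
        proj₂ I⟶M (zero-after-surjection (toImage f) (toImage-surjective f) g gf≡0))
      (⟦⟧-cong g (x≈y⇒x-y≈0 {L.mod} fx≈fy))
      where
      I = image f
      I⟶M : HomIsNonzero (sub I) M.mod
      I⟶M = ¬HomIsZero⇒HomIsNonzero λ I⊥M → f≢0 λ x → ↪⇒homIsZero L↪M I⊥M (incl I) (⟦ toImage f ⟧ x)
      g = proj₁ I⟶M

    injective⇒≅ : (f : Hom L.mod M.mod) → IsInjective f → M ⟶ L → L.mod ≅ M.mod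
    injective⇒≅ f f-inj (g , g≢0) = bijective⇒≅ f f-inj (surjective f λ y →
      let x , fgx≈y = preimage (f ∘ʰ g) fg-surj y in ⟦ g ⟧ x , fgx≈y)
      where
      fg-surj : IsSurjective (f ∘ʰ g)
      fg-surj = proj₂ (brick-endo-bijective M.isBrick (f ∘ʰ g) λ fg≡0 → g≢0 (zero-before-injection f f-inj g fg≡0))

    surjective⇒≅ : (f : Hom L.mod M.mod) → IsSurjective f → (g : Hom M.mod L.mod) → IsSurjective g → L.mod ≅ M.mod
    surjective⇒≅ f f-surj g g-surj = bijective⇒≅ f (λ fx≈fy → gf-inj (⟦⟧-cong g fx≈fy)) f-surj
      where
      gf-inj : IsInjective (g ∘ʰ f)
      -- The composite is surjective; were it zero too, L would have only the zero endomorphism.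
      gf-inj = proj₁ (brick-endo-bijective L.isBrick (g ∘ʰ f) λ gf≡0 →
        brick-endos-nonzero L λ h → zero-after-surjection (g ∘ʰ f) (∘-surjective g f g-surj f-surj) h λ x →
          LeftModule.≈ᴹ-trans L.mod (⟦⟧-cong h (gf≡0 x)) (0ᴹ-homo h))

  factorize : {L M : Brick} → L ⟶ M → ∃[ B ] (L ↠ B) × (B ↪ M)
  factorize {L} {M} (f , f≢0) =
    let n , spanned       = finiteDimensional (Brick.fd L)
        B , L-B , B-M = brick-in-endo-closed {𝒞} (λ {K} → images {K}) n (subᶠ (Brick.fd M) I)
                            (spanned-quotient (image-quotient f) spanned)
                            ( (λ N L⊥N → homIsZero-quotient (image-quotient f) L⊥N)
                            , (λ N N⊥M → homIsZero-submodule (sub-submodule I) N⊥M))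
                            λ I≡0 → f≢0 λ x →
                              subquotient-zero⁻ I (zeroSubmodule (Brick.mod M)) (⟦ toImage f ⟧ x) (I≡0 (⟦ toImage f ⟧ x))
    in B , homIsZero⇒↠ {L} {B} L-B , homIsZero⇒↪ {B} {M} B-M
    where
    I = image f
    -- The smallest torsion class containing L intersected with the smallest torsion-free class
    -- containing M, phrased as the hypotheses of `homIsZero⇒↠` and `homIsZero⇒↪`.
    𝒞 : Class
    𝒞 K = (∀ N → HomIsZero (Brick.mod L) (mod N) → HomIsZero (mod K) (mod N))
        × (∀ N → HomIsZero (mod N) (Brick.mod M) → HomIsZero (mod N) (mod K))
    images : ∀ {K} → K ∈ 𝒞 → (φ : Hom (mod K) (mod K)) → subᶠ K (image φ) ∈ 𝒞
    images (L-K , K-M) φ =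
        (λ N L⊥N → homIsZero-quotient (image-quotient φ) (L-K N L⊥N))
      , (λ N N⊥M → homIsZero-submodule (sub-submodule (image φ)) (K-M N N⊥M))

  -- The factorization system and its two-acyclicity.

  isFactorizationSystem : IsFactorizationSystem Bricks _⟶_ _↠_ _↪_
  isFactorizationSystem = record
    { ⟶-resp-≈ =
          (λ {x} {y} {z} y≅z x⟶y → ¬HomIsZero⇒HomIsNonzero λ x⊥z →
            nonzero⇒¬zero x⟶y (homIsZero-resp-target (B.mod z) (B.mod y) (≅-sym (B.mod y) (B.mod z) y≅z) x⊥z))
        , (λ {x} {y} {z} y≅z y⟶x → ¬HomIsZero⇒HomIsNonzero λ z⊥x →
            nonzero⇒¬zero y⟶x (homIsZero-resp-source (B.mod z) (B.mod y) (≅-sym (B.mod y) (B.mod z) y≅z) z⊥x))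
    ; ↠-resp-≈ =
          (λ {x} {y} {z} y≅z x↠y → homIsZero⇒↠ {x} {z} λ N x⊥N →
            homIsZero-resp-source (B.mod y) (B.mod z) y≅z (↠⇒homIsZero {x} {y} x↠y x⊥N))
        , (λ {x} {y} {z} y≅z y↠x → homIsZero⇒↠ {z} {x} λ N z⊥N →
            ↠⇒homIsZero {y} {x} y↠x (homIsZero-resp-source (B.mod z) (B.mod y) (≅-sym (B.mod y) (B.mod z) y≅z) z⊥N))
    ; ↪-resp-≈ =
          (λ {x} {y} {z} y≅z x↪y → homIsZero⇒↪ {x} {z} λ N N⊥z →
            ↪⇒homIsZero {x} {y} x↪y (homIsZero-resp-target (B.mod z) (B.mod y) (≅-sym (B.mod y) (B.mod z) y≅z) N⊥z))
        , (λ {x} {y} {z} y≅z y↪x → homIsZero⇒↪ {z} {x} λ N N⊥x →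
            homIsZero-resp-target (B.mod y) (B.mod z) y≅z (↪⇒homIsZero {y} {x} y↪x N⊥x))
    ; ⟶-refl = λ {x} → ¬HomIsZero⇒HomIsNonzero (brick-endos-nonzero x)
    ; fact-↠ =
          -- `x≥y` speaks of bricks only. A nonzero map from y to some N in x^⊥ would yield a brick
          -- B in x^⊥ with `y ⟶ B`, and then `x ⟶ B`, a contradiction.
          (λ {x} {y} x≥y → homIsZero⇒↠ {x} {y} λ N x⊥N →
            torsionFree-detected-by-bricks (^⊥ᴹ-isTorsionFreeClass ⟨ x ⟩) {N = N} (λ { refl → x⊥N })
              λ B x⊥B y⟶B → nonzero⇒¬zero (x≥y B y⟶B) (x⊥B refl))
        , (λ {x} {y} x↠y z y⟶z → ¬HomIsZero⇒HomIsNonzero λ x⊥z → nonzero⇒¬zero y⟶z (↠⇒homIsZero {x} {y} x↠y x⊥z))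
    ; fact-↪ =
          (λ {x} {y} x≤y → homIsZero⇒↪ {x} {y} λ N N⊥y →
            torsion-detected-by-bricks (⊥ᴹ^-isTorsionClass ⟨ y ⟩) {M = N} (λ { refl → N⊥y })
              λ B B⊥y B⟶x → nonzero⇒¬zero (x≤y B B⟶x) (B⊥y refl))
        , (λ {x} {y} x↪y z z⟶x → ¬HomIsZero⇒HomIsNonzero λ z⊥y → nonzero⇒¬zero z⟶x (↪⇒homIsZero {x} {y} x↪y z⊥y))
    ; mult =
          -- Vanishing of Hom(x,z) passes to Hom(y,z) along `x↠y` and then to Hom(y,y) along `y↪z`,
          -- against the identity of y.
          (λ {x} {z} (y , x↠y , y↪z) → ¬HomIsZero⇒HomIsNonzero λ x⊥z →
            brick-endos-nonzero y (↪⇒homIsZero {y} {z} y↪z (↠⇒homIsZero {x} {y} x↠y x⊥z)))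
        , λ {L} {M} → factorize {L} {M}
    }
    where module B = Brick

  isTwoAcyclic : IsTwoAcyclic Bricks _↠_ _↪_
  isTwoAcyclic = record
    { ↠-acyclic  = λ {x} {y} x↠y y↠x →
        let f , f≢0 = ↠⇒⟶ {x} {y} x↠y
            g , g≢0 = ↠⇒⟶ {y} {x} y↠x
        in surjective⇒≅ {x} {y} f (↠⇒surjective {y} {x} y↠x f f≢0) g (↠⇒surjective {x} {y} x↠y g g≢0)
    ; ↪-acyclic  = λ {x} {y} x↪y y↪x →
        let f , f≢0 = ↪⇒⟶ {x} {y} x↪y
        in injective⇒≅ {x} {y} f (↪⇒injective {y} {x} y↪x f f≢0) (↪⇒⟶ {y} {x} y↪x)
    -- Here `y↪x` does double duty: it makes `f` injective and supplies a nonzero map back.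
    ; ↠↪-acyclic = λ {x} {y} x↠y y↪x →
        let f , f≢0 = ↠⇒⟶ {x} {y} x↠y
        in injective⇒≅ {x} {y} f (↪⇒injective {y} {x} y↪x f f≢0) (↪⇒⟶ {y} {x} y↪x)
    }

  -- Torsion classes and maximal orthogonal pairs.

  open FactorizationSystems Bricks using (MaximalOrthogonalPair)
  open MaximalOrthogonalPair using (X; Y; Y≐X^⊥; X≐⊥^Y)
  open TorsionClass using (𝒯; isTorsionClass)

  restrictionsAreMaximal : RestrictionsAreMaximal
  restrictionsAreMaximal t = record
    { X-isSubset = resp-≅
    ; Y-isSubset = λ {x} {y} x≅y x∈ {L} L∈ → homIsZero-resp-target (Brick.mod x) (Brick.mod y) x≅y (x∈ L∈)
    ; Y≐X^⊥      = (λ y∈ x∈ x⟶y → nonzero⇒¬zero x⟶y (y∈ x∈))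
                 , (λ y∈ {L} L∈ → torsion-detected-by-bricks (isTorsionClass t) {L} L∈ λ B B∈ → y∈ {B} B∈)
    ; X≐⊥^Y      = (λ x∈ y∈ x⟶y → nonzero⇒¬zero x⟶y (y∈ x∈))
                 -- A nonzero map from x to a torsion-free module would yield a torsion-free brick
                 -- receiving one, so x lies in the double orthogonal of `𝒯 t`.
                 , (λ x∈ → ⊥⟨𝒯^⊥⟩⊆𝒯 (isTorsionClass t) λ {N} N∈ →
                     torsionFree-detected-by-bricks (^⊥ᴹ-isTorsionFreeClass (𝒯 t)) {N = N} (λ {L} → N∈ {L}) λ B B∈ →
                       x∈ {B} (λ {L} → B∈ {L}))
    }
    where open IsTorsionClass (isTorsionClass t)

  module _ (p : MaximalOrthogonalPair _⟶_ (suc ℓ)) where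

    private
      T F : Class
      T = FilteredByQuotientsOf (X p)
      F = FilteredBySubmodulesOf (Y p)

    X⊥Y : ∀ B C → B ∈ X p → C ∈ Y p → HomIsZero (Brick.mod B) (Brick.mod C)
    X⊥Y B C B∈ C∈ = ¬HomIsNonzero⇒HomIsZero (proj₁ (Y≐X^⊥ p) C∈ B∈)

    -- The only place where a nonbrick M and N are compared through the pair: a nonzero map would
    -- give a brick B left orthogonal to Y with a nonzero map to N, and maximality puts B in X.
    -- Hence M lies in ⊥(X^⊥) and N in (⊥Y)^⊥, where the greedy filtrations apply.
    ⊥Y⊥X^⊥ : ∀ {M N} → (∀ C → C ∈ Y p → HomIsZero (mod M) (Brick.mod C)) → (∀ B → B ∈ X p → HomIsZero (Brick.mod B) N) →
             HomIsZero (mod M) N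
    ⊥Y⊥X^⊥ {M} M⊥Y X⊥N =
      torsion-detected-by-bricks (⊥ᴹ^-isTorsionClass ⌊ Y p ⌋) {M} (λ { (C , C∈ , refl) → M⊥Y C C∈ }) λ B B⊥Y B⟶N →
        nonzero⇒¬zero B⟶N (X⊥N B (proj₂ (X≐⊥^Y p) λ {C} C∈ B⟶C → nonzero⇒¬zero B⟶C (B⊥Y (C , C∈ , refl))))

    T⇒homIsZero : ∀ {M N} → M ∈ T → (∀ B → B ∈ X p → HomIsZero (Brick.mod B) N) → HomIsZero (mod M) N
    T⇒homIsZero M∈ X⊥N = filtration-homIsZero-source M∈ λ (B , B∈ , Q) → homIsZero-quotient Q (X⊥N B B∈)

    F⇒homIsZero : ∀ {N M} → N ∈ F → (∀ C → C ∈ Y p → HomIsZero M (Brick.mod C)) → HomIsZero M (mod N)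
    F⇒homIsZero N∈ M⊥Y = filtration-homIsZero-target N∈ λ (C , C∈ , Q) → homIsZero-submodule Q (M⊥Y C C∈)

    ⊥Y⇒T : ∀ {M} → (∀ C → C ∈ Y p → HomIsZero (mod M) (Brick.mod C)) → M ∈ T
    ⊥Y⇒T {M} M⊥Y = filtration-map (λ { (_ , (B , B∈ , refl) , Q) → B , B∈ , Q })
      (∈⊥⟨^⊥⟩⇒filtration {⌊ X p ⌋} {M} λ {N} X⊥N → ⊥Y⊥X^⊥ {M} M⊥Y λ B B∈ → X⊥N (B , B∈ , refl))

    X^⊥⇒F : ∀ {N} → (∀ B → B ∈ X p → HomIsZero (Brick.mod B) (mod N)) → N ∈ F
    X^⊥⇒F {N} X⊥N = filtration-map (λ { (_ , (C , C∈ , refl) , Q) → C , C∈ , Q })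
      (∈⟨⊥^⟩⊥⇒filtration {⌊ Y p ⌋} {N} λ {M} M⊥Y → ⊥Y⊥X^⊥ {M} (λ C C∈ → M⊥Y (C , C∈ , refl)) X⊥N)

    X⊆T : ∀ B → B ∈ X p → Brick.fd B ∈ T
    X⊆T B B∈ = ⊥Y⇒T {Brick.fd B} λ C → X⊥Y B C B∈

    Y⊆F : ∀ C → C ∈ Y p → Brick.fd C ∈ F
    Y⊆F C C∈ = X^⊥⇒F {Brick.fd C} λ B B∈ → X⊥Y B C B∈ C∈

    -- Closure properties are not checked on filtrations. T is identified with the left orthogonal
    -- of Y and F with the right orthogonal of X, where closure is immediate.
    filtered-isTorsionPair : IsTorsionPair T F
    filtered-isTorsionPair = record
      { isTorsionClass     = isTorsionClass-resp-≐ {⊥ᴹ^ ⌊ Y p ⌋}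
          ( (λ {M} M⊥Y → ⊥Y⇒T {M} λ C C∈ → M⊥Y (C , C∈ , refl))
          , (λ { {M} M∈ (C , C∈ , refl) → T⇒homIsZero {M} M∈ λ B B∈ → X⊥Y B C B∈ C∈ }))
          (⊥ᴹ^-isTorsionClass ⌊ Y p ⌋)
      ; isTorsionFreeClass = isTorsionFreeClass-resp-≐ {⌊ X p ⌋ ^⊥ᴹ}
          ( (λ {N} X⊥N → X^⊥⇒F {N} λ B B∈ → X⊥N (B , B∈ , refl))
          , (λ { {N} N∈ (B , B∈ , refl) → F⇒homIsZero {N} N∈ λ C → X⊥Y B C B∈ }))
          (^⊥ᴹ-isTorsionFreeClass ⌊ X p ⌋)
      ; ℱ≐𝒯^⊥              = (λ {N} N∈ {M} M∈ → T⊥F {M} {N} M∈ N∈)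
                           , (λ {N} N∈ → X^⊥⇒F {N} λ B B∈ → N∈ (X⊆T B B∈))
      ; 𝒯≐⊥^ℱ              = (λ {M} M∈ {N} N∈ → T⊥F {M} {N} M∈ N∈)
                           , (λ {M} M∈ → ⊥Y⇒T {M} λ C C∈ → M∈ (Y⊆F C C∈))
      }
      where
      T⊥F : ∀ {M N} → M ∈ T → N ∈ F → HomIsZero (mod M) (mod N)
      T⊥F {M} {N} M∈ N∈ = T⇒homIsZero {M} M∈ λ B B∈ → F⇒homIsZero {N} N∈ λ C → X⊥Y B C B∈

  private
    module tors  = Poset tors
    module pairs = Poset BrickPairs

    R : tors.Carrier → pairs.Carrier
    R = restrict restrictionsAreMaximal

    E : pairs.Carrier → tors.Carrier
    E = extend filtered-isTorsionPair

  restrict-cong : ∀ {s t} → s tors.≈ t → R s pairs.≈ R t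
  restrict-cong (s≤t , t≤s) = (s≤t , t≤s) , (λ B∈ L∈ → B∈ (t≤s L∈)) , (λ B∈ L∈ → B∈ (s≤t L∈))

  -- A nonzero map from M in `s` to N right orthogonal to `t` would give one from a brick of `s`,
  -- which is also a brick of `t`. So M lies in the double orthogonal of `t`.
  restrict-cancel : ∀ {s t} → R s pairs.≤ R t → s tors.≤ t
  restrict-cancel {s} {t} Rs≤Rt M∈ = ⊥⟨𝒯^⊥⟩⊆𝒯 (isTorsionClass t) λ N∈ →
    torsion-detected-by-bricks (isTorsionClass s) M∈ λ B B∈ B⟶N → nonzero⇒¬zero B⟶N (N∈ (Rs≤Rt {B} B∈))

  restrict-injective : ∀ {s t} → R s pairs.≈ R t → s tors.≈ t
  restrict-injective {s} {t} ((Xs⊆Xt , Xt⊆Xs) , _) =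
    restrict-cancel {s} {t} (λ {B} → Xs⊆Xt {B}) , restrict-cancel {t} {s} (λ {B} → Xt⊆Xs {B})

  -- A brick filtered by quotients from X is left orthogonal to Y, hence in X by maximality. A brick
  -- right orthogonal to the whole torsion class is so to X, hence in Y.
  restrict-extend : ∀ p → R (E p) pairs.≈ p
  restrict-extend p =
      ( (λ {B} B∈ → proj₂ (X≐⊥^Y p) λ {C} C∈ B⟶C →
          nonzero⇒¬zero B⟶C (T⇒homIsZero p {Brick.fd B} B∈ λ B′ B′∈ → X⊥Y p B′ C B′∈ C∈))
      , (λ {B} → X⊆T p B))
    , ( (λ {C} C∈ → proj₂ (Y≐X^⊥ p) λ {B} B∈ B⟶C → nonzero⇒¬zero B⟶C (C∈ (X⊆T p B B∈)))
      , (λ {C} C∈ {M} M∈ → T⇒homIsZero p {M} M∈ λ B B∈ → X⊥Y p B C B∈ C∈))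

  restrict-inverseˡ : ∀ {p t} → t tors.≈ E p → R t pairs.≈ p
  restrict-inverseˡ {p} {t} t≈Ep =
    pairs.Eq.trans {R t} {R (E p)} {p} (restrict-cong {t} {E p} t≈Ep) (restrict-extend p)

  isOrderIso : IsOrderIso R
  isOrderIso = record
    { isOrderMonomorphism = record
      { isOrderHomomorphism = record
        { cong = λ {s} {t} → restrict-cong {s} {t}
        ; mono = λ s≤t → s≤t
        }
      ; injective = λ {s} {t} → restrict-injective {s} {t}
      ; cancel    = λ {s} {t} → restrict-cancel {s} {t}
      }
    ; surjective = λ p → E p , λ {t} → restrict-inverseˡ {p} {t}
    }

  areInverse : AreInverse R E
  areInverse =
      (λ {p} {t} → restrict-inverseˡ {p} {t})
    , (λ {t} {p} p≈Rt → restrict-injective {E p} {t}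
        (pairs.Eq.trans {R (E p)} {p} {R t} (restrict-extend p) p≈Rt))

open import Defs

theorem8p6 : {ℓ : Level} → ExcludedMiddle (suc ℓ) →
    (k : Field ℓ) (A : FiniteDimensionalAlgebra k) →
    IsFactorizationSystem (Bricks A) (_⟶_ A) (_↠_ A) (_↪_ A)
    × IsTwoAcyclic (Bricks A) (_↠_ A) (_↪_ A)
    × Σ[ isMaximal ∈ RestrictionsAreMaximal A ]
    Σ[ isTorsionPair ∈ FilteredClassesAreTorsionPairs A ]
    IsOrderIso A (restrict A isMaximal)
    × AreInverse A (restrict A isMaximal) (extend A isTorsionPair)
theorem8p6 em k A =
  isFactorizationSystem , isTwoAcyclic , restrictionsAreMaximal , filtered-isTorsionPair , isOrderIso , areInverse
  where open TorsionClassesAndBricks em A
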